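{- Let $p$ be a prime, $p>3$, and let $t\in D_p$. If $t\not\equiv 0\pmod p$, then modulo $p$: \begin{align*} \sum_{k=0}^{\lfloor p/6\rfloor}S_k\bigl(t^2(4t+1)\bigr)^k&\equiv \frac{1+12t}{32t}\left(\frac{1+4t}{p}\right)-\frac{1-12t}{32t}\left(\frac{1-12t}{p}\right),\\ \sum_{k=0}^{p-1}S_k\bigl(t^2(4t+1)\bigr)^k&\equiv \frac{(1+12t)(1+4t)(1-6t)}{32t}\left(\frac{1+4t}{p}\right)-\frac{(1-12t)(24t^2+6t+1)}{32t}\left(\frac{1-12t}{p}\right). \end{align*} If $6t+1\not\equiv 0\pmod p$, then modulo $p$: \begin{align*} \sum_{k=0}^{\lfloor p/6\rfloor}(2k+1)S_k\bigl(t^2(4t+1)\bigr)^k&\equiv \frac{1+12t}{8(1+6t)}\left(\frac{1-12t}{p}\right)+\frac{3(1+4t)}{8(1+6t)}\left(\frac{1+4t}{p}\right),\\ \sum_{k=0}^{p-1}(2k+1)S_k\bigl(t^2(4t+1)\bigr)^k&\equiv \frac{(1+12t)(24t^2+6t+1)}{8(1+6t)}\left(\frac{1-12t}{p}\right)+\frac{3(1-6t)(1+4t)^2}{8(1+6t)}\left(\frac{1+4t}{p}\right). \end{align*}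
   Context: $S_n=\frac{\binom{6n}{3n}\binom{3n}{n}}{2\binom{2n}{n}(2n+1)}$ for $n\ge 0$. $D_p$ is the set of rationals whose denominator is not divisible by $p$; congruences are in the usual sense. For $c=a/b\in D_p$ in lowest terms, $\left(\frac{c}{p}\right)=\left(\frac{ab}{p}\right)$ (Legendre symbol), which is $0$ if $p\mid a$. -}

module Defs where

open import Data.Bool using (Bool; true; false; if_then_else_)
open import Data.Nat as ℕ using (ℕ; zero; suc)
open import Data.Nat.Divisibility using (_∣_; _∣?_)
open import Data.Nat.Combinatorics using (_C_)
open import Data.Integer as ℤ using (ℤ; +_; ∣_∣)
open import Data.List using (List; upTo)
open import Data.Bool.ListAction using (any)
open import Data.Rational as ℚ using (ℚ; _/_; ↥_; ↧ₙ_; _+_; _*_; _-_; 1/_; 0ℚ; 1ℚ)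
open import Relation.Nullary.Decidable using (yes; no; does; ⌊_⌋)
open import Relation.Binary.PropositionalEquality using (_≡_)
open import Data.Empty using (⊥)

ℕ→ℚ : ℕ → ℚ
ℕ→ℚ n = + n / 1

ℤ→ℚ : ℤ → ℚ
ℤ→ℚ z = z / 1

infixr 8 _^_
_^_ : ℚ → ℕ → ℚ
x ^ zero = 1ℚ
x ^ suc n = x * (x ^ n)

-- total division on ℚ (x ÷ 0 := 0); only ever used with a nonzero divisor
infixl 7 _÷_
_÷_ : ℚ → ℚ → ℚ
x ÷ y with ℚ._≟_ y 0ℚ
... | yes _ = 0ℚ
... | no y≢0 = x * (1/ y) {{ℚ.≢-nonZero y≢0}}

S : ℕ → ℚ
S n = (ℕ→ℚ ((6 ℕ.* n) C (3 ℕ.* n)) * ℕ→ℚ ((3 ℕ.* n) C n))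
      ÷ (ℕ→ℚ 2 * ℕ→ℚ ((2 ℕ.* n) C n) * ℕ→ℚ (2 ℕ.* n ℕ.+ 1))

sumTo : ℕ → (ℕ → ℚ) → ℚ
sumTo zero f = f 0
sumTo (suc m) f = sumTo m f + f (suc m)

isSquareMod : ℕ → ℤ → Bool
isSquareMod p a = any (λ x → does (p ∣? ∣ (+ x) ℤ.* (+ x) ℤ.- a ∣)) (upTo p)

legendreℤ : ℤ → ℕ → ℤ
legendreℤ a p =
  if does (p ∣? ∣ a ∣) then + 0
  else (if isSquareMod p a then + 1 else ℤ.- (+ 1))

legendre : ℚ → ℕ → ℚ
legendre c p = ℤ→ℚ (legendreℤ ((↥ c) ℤ.* (+ (↧ₙ c))) p)

InD : ℕ → ℚ → Set
InD p c = (p ∣ ↧ₙ c) → ⊥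

-- c ≡ 0 (mod p) for c ∈ D_p: p divides the reduced numerator
≡0mod : ℕ → ℚ → Set
≡0mod p c = p ∣ ∣ ↥ c ∣

infix 4 _≡_[modℚ_]
_≡_[modℚ_] : ℚ → ℚ → ℕ → Set
a ≡ b [modℚ p ] = ≡0mod p (a - b)

{-# OPTIONS --safe #-}
module Submission where

-- S k is half the k-th coefficient of ₂F₁(1/6, 5/6; 3/2; 108x), so modulo p the sum up to ⌊p/6⌋ is a Chebyshev
-- polynomial sin((2m+1)z)/sin z in sin²z = 108x.  For x = t²(4t+1) one has z = 3w with 4sin²w = 3(1+4t) and
-- 4cos²w = 1-12t, and 3(2m+1) = p ± 2.  Since sin(pw)/sin w ≡ (-4sin²w)^((p-1)/2) and
-- cos(pw)/cos w ≡ (4cos²w)^((p-1)/2), addition formulas and Euler's criterion give the two Legendre symbols; the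
-- remaining sign (-3/p) is the case w = π/3.  The terms between ⌊p/6⌋ and (p-1)/2 vanish, and from (p-1)/2 on the
-- ratios S (k+1) / S k are those of ₂F₁(1/3, -1/3; 1/2; 108x), i.e. of 2cos(2Mz) with 3M = p ± 1.  Multiplying
-- the terms by 2k+1 replaces the sine by cos((2m+1)z)/cos z.

-- With p = 2N+1, the recurrence that expresses S (k+1) through S k has the factor 2k+3, which
-- equals p at k = N-1. It cannot be followed modulo p past this point: the sum is cut at N, and
-- besides S 0 = 1/2 a second start S N ≡ -1/4 is found from factorials, where the powers of p
-- cancel. On the two halves the recurrences match because (6m+1)(6m+5) ≡ 0 turns 36(m-k)(m+k+1)
-- into -(6k+1)(6k+5), and 9M² ≡ 1 turns 9(M-j)(M+j) into -(3j-1)(3j+1). No sine occurs in the code: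
-- quotients such as sin((2m+1)z)/sin z are integer polynomials in y = -4sin²z given by a recursion
-- in m, so each trigonometric identity is a ring identity carried along an induction and holds for
-- every integer y. Rationals are met only at the two ends, where they are exchanged for integers
-- with the same residue. The evaluations stay multiplied by their denominators, so that the
-- formulas over 8(1+6t) also cover t ≡ 0.

module ResidueComputation where

  open import Data.Bool using (true; false; T; if_then_else_)
  open import Data.Empty using (⊥; ⊥-elim; ⊥-elim-irr)
  open import Data.Integer using (ℤ; +_; -[1+_]; _+_; _*_; _-_; -_; _^_; ∣_∣)
  open import Data.Integer.Divisibility.Signed using (divides; ∣ᵤ⇒∣; ∣⇒∣ᵤ)
  open import Data.Integer.Properties using (*-zeroˡ; *-zeroʳ; *-identityˡ; *-identityʳ; *-cancelˡ-≡; +-identityˡ; +-identityʳ; +-injective; abs-*; i-j≡0⇒i≡j; pos-*; ^-zeroˡ; ^-distribˡ-+-*)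
  open import Data.Integer.Tactic.RingSolver using (solve-∀)
  open import Data.List using (upTo)
  open import Data.List.Membership.Propositional using (lose; find)
  open import Data.List.Membership.Propositional.Properties using (∈-upTo⁺)
  open import Data.List.Relation.Unary.Any.Properties using (any⁺; any⁻)
  open import Data.Nat as ℕ using (ℕ; zero; suc; z≤n; s≤s; z<s; s<s; _!)
  open import Data.Nat.Combinatorics using (_C_; nCk≡n!/k![n-k]!; k![n∸k]!∣n!)
  import Data.Nat.Divisibility as ℕ
  open import Data.Nat.DivMod using (m/n*n≡m; m≡m%n+[m/n]*n; m%n<n)
  open import Data.Nat.Primality using (Prime; euclidsLemma; prime⇒irreducible; prime⇒nonTrivial)
  import Data.Nat.Properties as ℕ
  import Data.Nat.Tactic.RingSolver as ℕ-Solver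
  open import Data.Product using (_×_; _,_; proj₁; proj₂; ∃)
  open import Data.Rational as ℚ using (ℚ; mkℚ; toℚᵘ; ↥_; ↧ₙ_; 0ℚ; 1ℚ)
  import Data.Rational.Properties as ℚ
  open import Data.Rational.Solver using (module +-*-Solver)
  open import Data.Rational.Unnormalised as ℚᵘ using (mkℚᵘ; *≡*)
  import Data.Rational.Unnormalised.Properties as ℚᵘ
  open import Data.Sum using (_⊎_; inj₁; inj₂; [_,_]′)
  open import Data.Vec using (Vec; []; _∷_)
  open import Defs using (ℕ→ℚ; ℤ→ℚ; S; sumTo; isSquareMod; legendreℤ; legendre; InD; ≡0mod; _≡_[modℚ_]; _÷_) renaming (_^_ to _^ℚ_)
  open import Relation.Binary.PropositionalEquality
  open import Relation.Nullary using (¬_; Dec; yes; no; does; contradiction)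
  open +-*-Solver using (solve; _:+_; _:*_; _:=_)

  -- Integer identities as linear combinations

  -- The last argument is a certificate: x - y is a combination of differences known to vanish.
  lin₁ : ∀ {x y a b} k → a ≡ b → x - y ≡ k * (a - b) → x ≡ y
  lin₁ {x} {y} {a} k refl eq = i-j≡0⇒i≡j x y (trans eq (lemma k a))
    where
    lemma : ∀ k a → k * (a - a) ≡ + 0
    lemma = solve-∀

  lin₂ : ∀ {x y a b c d} k l → a ≡ b → c ≡ d → x - y ≡ k * (a - b) + l * (c - d) → x ≡ y
  lin₂ {x} {y} {a} {b} {c} k l p refl eq = lin₁ k p (trans eq (lemma k l a b c))
    where
    lemma : ∀ k l a b c → k * (a - b) + l * (c - c) ≡ k * (a - b)
    lemma = solve-∀

  lin₃ : ∀ {x y a b c d e f} k l n → a ≡ b → c ≡ d → e ≡ f →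
         x - y ≡ k * (a - b) + l * (c - d) + n * (e - f) → x ≡ y
  lin₃ {x} {y} {a} {b} {c} {d} {e} k l n p q refl eq = lin₂ k l p q (trans eq (lemma k l n a b c d e))
    where
    lemma : ∀ k l n a b c d e → k * (a - b) + l * (c - d) + n * (e - e) ≡ k * (a - b) + l * (c - d)
    lemma = solve-∀

  -- Chebyshev coefficients and their recurrences

  -- With y = -4sin²z, evenCoef m lists the coefficients in y of cos((2m+1)z)/cos z and oddCoef m those of
  -- sin(2mz)/sin(2z); in closed form they are C(m+k,2k) and C(m+k,2k+1).
  mutual
    evenCoef : ℕ → ℕ → ℤ
    evenCoef zero    zero    = + 1
    evenCoef zero    (suc k) = + 0
    evenCoef (suc m) zero    = evenCoef m zero
    evenCoef (suc m) (suc k) = evenCoef m (suc k) + oddCoef (suc m) k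

    oddCoef : ℕ → ℕ → ℤ
    oddCoef zero    k = + 0
    oddCoef (suc m) k = oddCoef m k + evenCoef m k

  evenCoef-0 : ∀ m → evenCoef m 0 ≡ + 1
  evenCoef-0 zero    = refl
  evenCoef-0 (suc m) = evenCoef-0 m

  -- The quotients C(m+k,2k+1)/C(m+k,2k) = (m-k)/(2k+1) and C(m+k+1,2k+2)/C(m+k,2k+1) =
  -- (m+k+1)/(2k+2), cross-multiplied. The induction on m needs both at once.
  oddCoef-ratio : ∀ m k → (+ 2 * + k + + 1) * oddCoef m k ≡ (+ m - + k) * evenCoef m k
  evenCoef-ratio : ∀ m k → (+ 2 * + k + + 2) * evenCoef m (suc k) ≡ (+ m + + k + + 1) * oddCoef m k

  oddCoef-ratio zero zero = refl
  oddCoef-ratio zero (suc k) = trans (*-zeroʳ (+ 2 * + suc k + + 1)) (sym (*-zeroʳ (+ 0 - + suc k)))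
  oddCoef-ratio (suc m) zero = lin₁ (+ 1) (oddCoef-ratio m 0) (lemma (+ m) (oddCoef m 0) (evenCoef m 0))
    where
    lemma : ∀ m c b → (+ 2 * + 0 + + 1) * (c + b) - (+ 1 + m - + 0) * b
          ≡ + 1 * ((+ 2 * + 0 + + 1) * c - (m - + 0) * b)
    lemma = solve-∀
  oddCoef-ratio (suc m) (suc k) =
    lin₂ (+ 1) (- + 1)
      (oddCoef-ratio m (suc k)) (evenCoef-step m k)
      (lemma (+ m) (+ k) (oddCoef m (suc k)) (evenCoef m (suc k)) (oddCoef m k) (evenCoef m k))
    where
    lemma : ∀ m k c b c₀ b₀ → (+ 2 * (+ 1 + k) + + 1) * (c + b) - (+ 1 + m - (+ 1 + k)) * (b + (c₀ + b₀))
          ≡ + 1 * ((+ 2 * (+ 1 + k) + + 1) * c - (m - (+ 1 + k)) * b)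
          + (- + 1) * ((m - k) * (b + (c₀ + b₀)) - (m + k + + 2) * b)
    lemma = solve-∀
    -- The quotient C(m+k+2,2k+2)/C(m+k+1,2k+2) = (m+k+2)/(m-k).
    evenCoef-step : ∀ m k → (+ m - + k) * (evenCoef m (suc k) + (oddCoef m k + evenCoef m k))
                  ≡ (+ m + + k + + 2) * evenCoef m (suc k)
    evenCoef-step m k = lin₂ (- + 1) (- + 1) (oddCoef-ratio m k) (evenCoef-ratio m k)
      (lemma′ (+ m) (+ k) (evenCoef m (suc k)) (oddCoef m k) (evenCoef m k))
      where
      lemma′ : ∀ m k b c₀ b₀ → (m - k) * (b + (c₀ + b₀)) - (m + k + + 2) * b
             ≡ (- + 1) * ((+ 2 * k + + 1) * c₀ - (m - k) * b₀)
             + (- + 1) * ((+ 2 * k + + 2) * b - (m + k + + 1) * c₀)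
      lemma′ = solve-∀

  evenCoef-ratio zero k = trans (*-zeroʳ (+ 2 * + k + + 2)) (sym (*-zeroʳ (+ 0 + + k + + 1)))
  evenCoef-ratio (suc m) k = lin₂ (+ 1) (- + 1) (evenCoef-ratio m k) (sym (oddCoef-ratio m k))
    (lemma (+ m) (+ k) (evenCoef m (suc k)) (oddCoef m k) (evenCoef m k))
    where
    lemma : ∀ m k b c₀ b₀ → (+ 2 * k + + 2) * (b + (c₀ + b₀)) - (+ 1 + m + k + + 1) * (c₀ + b₀)
          ≡ + 1 * ((+ 2 * k + + 2) * b - (m + k + + 1) * c₀)
          + (- + 1) * ((m - k) * b₀ - (+ 2 * k + + 1) * c₀)
    lemma = solve-∀

  -- sin((2m+1)z)/sin z and 2cos(2mz)
  sinCoef : ℕ → ℕ → ℤ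
  sinCoef m k = evenCoef m k + + 2 * oddCoef m k

  cosCoef : ℕ → ℕ → ℤ
  cosCoef m zero    = + 2
  cosCoef m (suc k) = + 2 * evenCoef m (suc k) - oddCoef m k

  sinCoef-even : ∀ m k → (+ 2 * + k + + 1) * sinCoef m k ≡ (+ 2 * + m + + 1) * evenCoef m k
  sinCoef-even m k = lin₁ (+ 2) (oddCoef-ratio m k) (lemma (+ m) (+ k) (evenCoef m k) (oddCoef m k))
    where
    lemma : ∀ m k b c → (+ 2 * k + + 1) * (b + + 2 * c) - (+ 2 * m + + 1) * b
          ≡ + 2 * ((+ 2 * k + + 1) * c - (m - k) * b)
    lemma = solve-∀

  sinCoef-odd : ∀ m k → (+ m - + k) * sinCoef m k ≡ (+ 2 * + m + + 1) * oddCoef m k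
  sinCoef-odd m k = lin₁ (- + 1) (oddCoef-ratio m k) (lemma (+ m) (+ k) (evenCoef m k) (oddCoef m k))
    where
    lemma : ∀ m k b c → (m - k) * (b + + 2 * c) - (+ 2 * m + + 1) * c
          ≡ (- + 1) * ((+ 2 * k + + 1) * c - (m - k) * b)
    lemma = solve-∀

  -- Eliminating `evenCoef` and `oddCoef` leaves the term ratio of ₂F₁(-m, m+1; 3/2; sin²z), the
  -- form in which the coefficients can be compared with `S`.
  sinCoef-ratio : ∀ m k → + 2 * (+ k + + 1) * (+ 2 * + k + + 3) * sinCoef m (suc k)
                ≡ (+ m - + k) * (+ m + + k + + 1) * sinCoef m k
  sinCoef-ratio m k = lin₃ (+ 2 * + k + + 2) (+ 2 * + m + + 1) (- (+ m + + k + + 1))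
    (sinCoef-even m (suc k)) (evenCoef-ratio m k) (sinCoef-odd m k)
    (lemma (+ m) (+ k) (sinCoef m (suc k)) (evenCoef m (suc k)) (oddCoef m k) (sinCoef m k))
    where
    lemma : ∀ m k q′ b′ c q → + 2 * (k + + 1) * (+ 2 * k + + 3) * q′ - (m - k) * (m + k + + 1) * q
          ≡ (+ 2 * k + + 2) * ((+ 2 * (+ 1 + k) + + 1) * q′ - (+ 2 * m + + 1) * b′)
          + (+ 2 * m + + 1) * ((+ 2 * k + + 2) * b′ - (m + k + + 1) * c)
          + (- (m + k + + 1)) * ((m - k) * q - (+ 2 * m + + 1) * c)
    lemma = solve-∀

  -- The derivative of 2cos(2mz) with respect to y is m sin(2mz)/sin(2z).
  cosCoef-odd : ∀ m k → (+ k + + 1) * cosCoef m (suc k) ≡ + m * oddCoef m k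
  cosCoef-odd m k = lin₁ (+ 1) (evenCoef-ratio m k) (lemma (+ m) (+ k) (evenCoef m (suc k)) (oddCoef m k))
    where
    lemma : ∀ m k b c → (k + + 1) * (+ 2 * b - c) - m * c ≡ + 1 * ((+ 2 * k + + 2) * b - (m + k + + 1) * c)
    lemma = solve-∀

  cosCoef-even : ∀ m k → (+ m + + k) * cosCoef m k ≡ + 2 * + m * evenCoef m k
  cosCoef-even m zero rewrite evenCoef-0 m = lemma (+ m)
    where
    lemma : ∀ m → (m + + 0) * + 2 ≡ + 2 * m * + 1
    lemma = solve-∀
  cosCoef-even m (suc k) = lin₁ (+ 1) (evenCoef-ratio m k) (lemma (+ m) (+ k) (evenCoef m (suc k)) (oddCoef m k))
    where
    lemma : ∀ m k b c → (m + (+ 1 + k)) * (+ 2 * b - c) - + 2 * m * b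
          ≡ + 1 * ((+ 2 * k + + 2) * b - (m + k + + 1) * c)
    lemma = solve-∀

  -- The term ratio of ₂F₁(-m, m; 1/2; sin²z).
  cosCoef-ratio : ∀ m k → + 2 * (+ k + + 1) * (+ 2 * + k + + 1) * cosCoef m (suc k)
                ≡ (+ m - + k) * (+ m + + k) * cosCoef m k
  cosCoef-ratio m k = lin₃ (+ 2 * (+ 2 * + k + + 1)) (+ 2 * + m) (- (+ m - + k))
    (cosCoef-odd m k) (oddCoef-ratio m k) (cosCoef-even m k)
    (lemma (+ m) (+ k) (cosCoef m (suc k)) (oddCoef m k) (cosCoef m k) (evenCoef m k))
    where
    lemma : ∀ m k v′ c v b → + 2 * (k + + 1) * (+ 2 * k + + 1) * v′ - (m - k) * (m + k) * v
          ≡ (+ 2 * (+ 2 * k + + 1)) * ((k + + 1) * v′ - m * c)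
          + (+ 2 * m) * ((+ 2 * k + + 1) * c - (m - k) * b)
          + (- (m - k)) * ((m + k) * v - + 2 * m * b)
    lemma = solve-∀

  -- Finite sums and evaluation of coefficient sequences

  sum : ℕ → (ℕ → ℤ) → ℤ
  sum zero    f = f 0
  sum (suc n) f = sum n f + f (suc n)

  sum-cong : ∀ n {f g} → (∀ k → f k ≡ g k) → sum n f ≡ sum n g
  sum-cong zero    h = h 0
  sum-cong (suc n) h = cong₂ _+_ (sum-cong n h) (h (suc n))

  sum-+ : ∀ n f g → sum n (λ k → f k + g k) ≡ sum n f + sum n g
  sum-+ zero    f g = refl
  sum-+ (suc n) f g = trans (cong (_+ (f (suc n) + g (suc n))) (sum-+ n f g))
    (lemma (sum n f) (sum n g) (f (suc n)) (g (suc n)))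
    where
    lemma : ∀ a b c d → a + b + (c + d) ≡ a + c + (b + d)
    lemma = solve-∀

  sum-* : ∀ n x f → sum n (λ k → x * f k) ≡ x * sum n f
  sum-* zero    x f = refl
  sum-* (suc n) x f = trans (cong (_+ x * f (suc n)) (sum-* n x f)) (lemma x (sum n f) (f (suc n)))
    where
    lemma : ∀ x a b → x * a + x * b ≡ x * (a + b)
    lemma = solve-∀

  sum-0 : ∀ n → sum n (λ _ → + 0) ≡ + 0
  sum-0 zero    = refl
  sum-0 (suc n) = trans (+-identityʳ _) (sum-0 n)

  sum-split : ∀ n k f → sum (n ℕ.+ suc k) f ≡ sum n f + sum k (λ j → f (suc n ℕ.+ j))
  sum-split n zero f rewrite ℕ.+-comm n 1 | ℕ.+-identityʳ n = refl
  sum-split n (suc k) f rewrite ℕ.+-suc n (suc k) =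
    trans (cong (_+ f (suc (n ℕ.+ suc k))) (sum-split n k f))
      (lemma (sum n f) (sum k (λ j → f (suc n ℕ.+ j))) _)
    where
    lemma : ∀ a b c → a + b + c ≡ a + (b + c)
    lemma = solve-∀

  eval : ℕ → (ℕ → ℤ) → ℤ → ℤ
  eval n f y = sum n (λ k → f k * y ^ k)

  eval-+ : ∀ n f g y → eval n (λ k → f k + g k) y ≡ eval n f y + eval n g y
  eval-+ n f g y = trans (sum-cong n (λ k → lemma (f k) (g k) (y ^ k))) (sum-+ n (λ k → f k * y ^ k) (λ k → g k * y ^ k))
    where
    lemma : ∀ a b c → (a + b) * c ≡ a * c + b * c
    lemma = solve-∀

  eval-* : ∀ n x f y → eval n (λ k → x * f k) y ≡ x * eval n f y
  eval-* n x f y = trans (sum-cong n (λ k → lemma x (f k) (y ^ k))) (sum-* n x (λ k → f k * y ^ k))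
    where
    lemma : ∀ a b c → a * b * c ≡ a * (b * c)
    lemma = solve-∀

  eval-suc : ∀ n f y → eval (suc n) f y ≡ f 0 + y * eval n (λ k → f (suc k)) y
  eval-suc n f y = trans (sum-split 0 n (λ k → f k * y ^ k))
    (cong₂ _+_ (*-identityʳ (f 0))
      (trans (sum-cong n (λ k → lemma (f (suc k)) y (y ^ k))) (sum-* n y (λ k → f (suc k) * y ^ k))))
    where
    lemma : ∀ a y c → a * (y * c) ≡ y * (a * c)
    lemma = solve-∀

  -- For y = -4sin²z, `even y m` is cos((2m+1)z)/cos z and `odd y m` is sin(2mz)/sin(2z); `sine` and
  -- `cosine` are then sin((2m+1)z)/sin z and 2cos(2mz).
  mutual
    even : ℤ → ℕ → ℤ
    even y zero    = + 1
    even y (suc m) = even y m + y * odd y (suc m)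

    odd : ℤ → ℕ → ℤ
    odd y zero    = + 0
    odd y (suc m) = odd y m + even y m

  sine cosine : ℤ → ℕ → ℤ
  sine   y m = even y m + + 2 * odd y m
  cosine y m = + 2 * even y m - y * odd y m

  -- The coefficients above degree m vanish, so every cut-off m+d gives the same value. A free d is
  -- needed by the induction, which trades m+1 and d for m and d+1.
  eval-evenCoef : ∀ m d y → eval (m ℕ.+ d) (evenCoef m) y ≡ even y m
  eval-oddCoef : ∀ m d y → eval (m ℕ.+ d) (oddCoef m) y ≡ odd y m

  eval-evenCoef zero zero    y = refl
  eval-evenCoef zero (suc d) y = trans (eval-suc d (evenCoef 0) y)
    (cong (_+_ (+ 1)) (trans (cong (y *_) (trans (sum-cong d (λ k → *-zeroˡ (y ^ k))) (sum-0 d))) (*-zeroʳ y)))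
  eval-evenCoef (suc m) d y = begin
    eval (suc (m ℕ.+ d)) (evenCoef (suc m)) y
      ≡⟨ eval-suc (m ℕ.+ d) (evenCoef (suc m)) y ⟩
    evenCoef m 0 + y * eval (m ℕ.+ d) (λ k → evenCoef m (suc k) + oddCoef (suc m) k) y
      ≡⟨ cong (λ z → evenCoef m 0 + y * z) (eval-+ (m ℕ.+ d) (λ k → evenCoef m (suc k)) (oddCoef (suc m)) y) ⟩
    evenCoef m 0 + y * (eval (m ℕ.+ d) (λ k → evenCoef m (suc k)) y + eval (m ℕ.+ d) (oddCoef (suc m)) y)
      ≡⟨ lemma (evenCoef m 0) y _ _ ⟩
    evenCoef m 0 + y * eval (m ℕ.+ d) (λ k → evenCoef m (suc k)) y + y * eval (m ℕ.+ d) (oddCoef (suc m)) y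
      ≡⟨ cong₂ (λ u v → u + y * v) (sym (eval-suc (m ℕ.+ d) (evenCoef m) y)) (eval-+ (m ℕ.+ d) (oddCoef m) (evenCoef m) y) ⟩
    eval (suc (m ℕ.+ d)) (evenCoef m) y + y * (eval (m ℕ.+ d) (oddCoef m) y + eval (m ℕ.+ d) (evenCoef m) y)
      ≡⟨ cong₂ (λ u v → u + y * v)
           (trans (cong (λ n → eval n (evenCoef m) y) (sym (ℕ.+-suc m d))) (eval-evenCoef m (suc d) y))
           (cong₂ _+_ (eval-oddCoef m d y) (eval-evenCoef m d y)) ⟩
    even y (suc m) ∎
    where
    open ≡-Reasoning
    lemma : ∀ a y b c → a + y * (b + c) ≡ a + y * b + y * c
    lemma = solve-∀

  eval-oddCoef zero d y = trans (sum-cong d (λ k → *-zeroˡ (y ^ k))) (sum-0 d)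
  eval-oddCoef (suc m) d y = begin
    eval (suc (m ℕ.+ d)) (oddCoef (suc m)) y
      ≡⟨ eval-+ (suc (m ℕ.+ d)) (oddCoef m) (evenCoef m) y ⟩
    eval (suc (m ℕ.+ d)) (oddCoef m) y + eval (suc (m ℕ.+ d)) (evenCoef m) y
      ≡⟨ cong (λ n → eval n (oddCoef m) y + eval n (evenCoef m) y) (sym (ℕ.+-suc m d)) ⟩
    eval (m ℕ.+ suc d) (oddCoef m) y + eval (m ℕ.+ suc d) (evenCoef m) y
      ≡⟨ cong₂ _+_ (eval-oddCoef m (suc d) y) (eval-evenCoef m (suc d) y) ⟩
    odd y (suc m) ∎
    where open ≡-Reasoning

  eval-sinCoef : ∀ m d y → eval (m ℕ.+ d) (sinCoef m) y ≡ sine y m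
  eval-sinCoef m d y = trans (eval-+ (m ℕ.+ d) (evenCoef m) (λ k → + 2 * oddCoef m k) y)
    (cong₂ _+_ (eval-evenCoef m d y)
      (trans (eval-* (m ℕ.+ d) (+ 2) (oddCoef m) y) (cong (+ 2 *_) (eval-oddCoef m d y))))

  -- The coefficients after multiplication by y.
  shift : (ℕ → ℤ) → ℕ → ℤ
  shift f zero    = + 0
  shift f (suc k) = f k

  eval-shift : ∀ m d y → eval (suc m ℕ.+ d) (shift (oddCoef (suc m))) y ≡ y * odd y (suc m)
  eval-shift m d y = begin
    eval (suc (m ℕ.+ d)) (shift (oddCoef (suc m))) y
      ≡⟨ eval-suc (m ℕ.+ d) (shift (oddCoef (suc m))) y ⟩
    + 0 + y * eval (m ℕ.+ d) (oddCoef (suc m)) y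
      ≡⟨ +-identityˡ _ ⟩
    y * eval (m ℕ.+ d) (oddCoef (suc m)) y
      ≡⟨ cong (y *_) (eval-+ (m ℕ.+ d) (oddCoef m) (evenCoef m) y) ⟩
    y * (eval (m ℕ.+ d) (oddCoef m) y + eval (m ℕ.+ d) (evenCoef m) y)
      ≡⟨ cong (y *_) (cong₂ _+_ (eval-oddCoef m d y) (eval-evenCoef m d y)) ⟩
    y * odd y (suc m) ∎
    where open ≡-Reasoning

  eval-cosCoef : ∀ m d y → eval (suc m ℕ.+ d) (cosCoef (suc m)) y ≡ cosine y (suc m)
  eval-cosCoef m d y = begin
    eval n (cosCoef (suc m)) y
      ≡⟨ sum-cong n (λ k → cong (_* y ^ k) (split k)) ⟩
    eval n (λ k → + 2 * evenCoef (suc m) k + - + 1 * shift (oddCoef (suc m)) k) y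
      ≡⟨ eval-+ n (λ k → + 2 * evenCoef (suc m) k) (λ k → - + 1 * shift (oddCoef (suc m)) k) y ⟩
    eval n (λ k → + 2 * evenCoef (suc m) k) y + eval n (λ k → - + 1 * shift (oddCoef (suc m)) k) y
      ≡⟨ cong₂ _+_ (eval-* n (+ 2) (evenCoef (suc m)) y) (eval-* n (- + 1) (shift (oddCoef (suc m))) y) ⟩
    + 2 * eval n (evenCoef (suc m)) y + - + 1 * eval n (shift (oddCoef (suc m))) y
      ≡⟨ cong₂ (λ u v → + 2 * u + - + 1 * v) (eval-evenCoef (suc m) d y) (eval-shift m d y) ⟩
    + 2 * even y (suc m) + - + 1 * (y * odd y (suc m))
      ≡⟨ lemma (even y (suc m)) (y * odd y (suc m)) ⟩
    cosine y (suc m) ∎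
    where
    open ≡-Reasoning
    n : ℕ
    n = suc m ℕ.+ d
    lemma : ∀ a b → + 2 * a + - + 1 * b ≡ + 2 * a - b
    lemma = solve-∀
    split : ∀ k → cosCoef (suc m) k ≡ + 2 * evenCoef (suc m) k + - + 1 * shift (oddCoef (suc m)) k
    split zero    rewrite evenCoef-0 m = refl
    split (suc k) = sym (lemma (evenCoef (suc m) (suc k)) (oddCoef (suc m) k))

  -- Pythagoras, doubling, tripling and reflection

  -- The recursion preserves this quadratic form. Four times it is (4+y) even² - y sine², that is
  -- 4cos² + 4sin² at the angle (2n+1)z.
  even²-odd² : ∀ y n → even y n * even y n - y * even y n * odd y n - y * odd y n * odd y n ≡ + 1
  even²-odd² y zero    = lemma y
    where
    lemma : ∀ y → + 1 * + 1 - y * + 1 * + 0 - y * + 0 * + 0 ≡ + 1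
    lemma = solve-∀
  even²-odd² y (suc n) = trans (lemma y (even y n) (odd y n)) (even²-odd² y n)
    where
    lemma : ∀ y b c → (b + y * (c + b)) * (b + y * (c + b)) - y * (b + y * (c + b)) * (c + b) - y * (c + b) * (c + b)
          ≡ b * b - y * b * c - y * c * c
    lemma = solve-∀

  -- `even` and `sine` at n belong to the angle (2n+1)z and `odd` at n to 2nz, so doubling the
  -- former angle leads to index 2n+1. Raising n by one moves that index by two and mixes `even`
  -- with `odd`; hence the joint induction.
  even-double : ∀ y n → even y (suc (n ℕ.+ n))
    ≡ (+ 1 + y) * even y n * even y n + + 2 * y * even y n * odd y n + y * odd y n * odd y n
  odd-double : ∀ y n → odd y (suc (n ℕ.+ n)) ≡ even y n * even y n + + 2 * even y n * odd y n

  even-double y zero = lemma y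
    where
    lemma : ∀ y → + 1 + y * (+ 0 + + 1) ≡ (+ 1 + y) * + 1 * + 1 + + 2 * y * + 1 * + 0 + y * + 0 * + 0
    lemma = solve-∀
  even-double y (suc n) rewrite ℕ.+-suc n n =
    trans (cong₂ (λ b c → b + y * (c + b) + y * (c + b + (b + y * (c + b)))) (even-double y n) (odd-double y n))
      (lemma y (even y n) (odd y n))
    where
    lemma : ∀ y b c →
      let b₁ = (+ 1 + y) * b * b + + 2 * y * b * c + y * c * c
          c₁ = b * b + + 2 * b * c
          c₂ = c + b
          b₂ = b + y * c₂
      in b₁ + y * (c₁ + b₁) + y * (c₁ + b₁ + (b₁ + y * (c₁ + b₁)))
         ≡ (+ 1 + y) * b₂ * b₂ + + 2 * y * b₂ * c₂ + y * c₂ * c₂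
    lemma = solve-∀
  odd-double y zero = refl
  odd-double y (suc n) rewrite ℕ.+-suc n n =
    trans (cong₂ (λ b c → c + b + (b + y * (c + b))) (even-double y n) (odd-double y n))
      (lemma y (even y n) (odd y n))
    where
    lemma : ∀ y b c →
      let b₁ = (+ 1 + y) * b * b + + 2 * y * b * c + y * c * c
          c₁ = b * b + + 2 * b * c
          c₂ = c + b
          b₂ = b + y * c₂
      in c₁ + b₁ + (b₁ + y * (c₁ + b₁)) ≡ b₂ * b₂ + + 2 * b₂ * c₂
    lemma = solve-∀

  -- Sends -4sin²w to -4sin²(3w).
  triple : ℤ → ℤ
  triple y = y * (+ 3 + y) * (+ 3 + y)

  -- The factors 3+y and 1+y, here and in the later tripling formulas, are sin 3w/sin w and cos
  -- 3w/cos w.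
  even-triple : ∀ y m → even y (m ℕ.+ (m ℕ.+ m)) ≡ even (triple y) m - y * (+ 3 + y) * odd (triple y) m
  odd-triple : ∀ y m → odd y (m ℕ.+ (m ℕ.+ m)) ≡ (+ 1 + y) * (+ 3 + y) * odd (triple y) m

  even-triple y zero = lemma y
    where
    lemma : ∀ y → + 1 ≡ + 1 - y * (+ 3 + y) * + 0
    lemma = solve-∀
  even-triple y (suc m) rewrite ℕ.+-suc m (m ℕ.+ suc m) | ℕ.+-suc m m | ℕ.+-suc m (m ℕ.+ m) =
    trans (cong₂ (λ b c →
        let c₁ = c + b
            b₁ = b + y * c₁
            c₂ = c₁ + b₁
            b₂ = b₁ + y * c₂
        in b₂ + y * (c₂ + b₂)) (even-triple y m) (odd-triple y m))
      (lemma y (even (triple y) m) (odd (triple y) m))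
    where
    lemma : ∀ y β γ →
        let b = β - y * (+ 3 + y) * γ
            c = (+ 1 + y) * (+ 3 + y) * γ
            c₁ = c + b
            b₁ = b + y * c₁
            c₂ = c₁ + b₁
            b₂ = b₁ + y * c₂
            z = y * (+ 3 + y) * (+ 3 + y)
        in b₂ + y * (c₂ + b₂) ≡ β + z * (γ + β) - y * (+ 3 + y) * (γ + β)
    lemma = solve-∀
  odd-triple y zero = sym (*-zeroʳ ((+ 1 + y) * (+ 3 + y)))
  odd-triple y (suc m) rewrite ℕ.+-suc m (m ℕ.+ suc m) | ℕ.+-suc m m | ℕ.+-suc m (m ℕ.+ m) =
    trans (cong₂ (λ b c →
        let c₁ = c + b
            b₁ = b + y * c₁
            c₂ = c₁ + b₁
            b₂ = b₁ + y * c₂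
        in c₂ + b₂) (even-triple y m) (odd-triple y m))
      (lemma y (even (triple y) m) (odd (triple y) m))
    where
    lemma : ∀ y β γ →
        let b = β - y * (+ 3 + y) * γ
            c = (+ 1 + y) * (+ 3 + y) * γ
            c₁ = c + b
            b₁ = b + y * c₁
            c₂ = c₁ + b₁
            b₂ = b₁ + y * c₂
        in c₂ + b₂ ≡ (+ 1 + y) * (+ 3 + y) * (γ + β)
    lemma = solve-∀

  -- The substitution z ↦ z + π/2 turns y = -4sin²z into -4 - y.
  odd-reflect : ∀ y n → odd (- + 4 - y) n ≡ - (- + 1) ^ n * odd y n
  even-reflect : ∀ y n → even (- + 4 - y) n ≡ (- + 1) ^ n * sine y n

  odd-reflect y zero = refl
  odd-reflect y (suc n) = trans (cong₂ _+_ (odd-reflect y n) (even-reflect y n))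
    (lemma ((- + 1) ^ n) (odd y n) (even y n))
    where
    lemma : ∀ s c b → - s * c + s * (b + + 2 * c) ≡ - (- + 1 * s) * (c + b)
    lemma = solve-∀
  even-reflect y zero = refl
  even-reflect y (suc n) = trans
    (cong₂ (λ c b → b + (- + 4 - y) * (c + b)) (odd-reflect y n) (even-reflect y n))
    (lemma y ((- + 1) ^ n) (odd y n) (even y n))
    where
    lemma : ∀ y s c b → s * (b + + 2 * c) + (- + 4 - y) * (- s * c + s * (b + + 2 * c))
          ≡ - + 1 * s * (b + y * (c + b) + + 2 * (c + b))
    lemma = solve-∀

  sine-reflect : ∀ y n → sine (- + 4 - y) n ≡ (- + 1) ^ n * even y n
  sine-reflect y n = trans (cong₂ (λ b c → b + + 2 * c) (even-reflect y n) (odd-reflect y n))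
    (lemma ((- + 1) ^ n) (odd y n) (even y n))
    where
    lemma : ∀ s c b → s * (b + + 2 * c) + + 2 * (- s * c) ≡ s * b
    lemma = solve-∀

  -- At y = -3 the angle is π/3, so the values are periodic.
  even-[-3] : ∀ m → even (- + 3) (m ℕ.+ (m ℕ.+ m)) ≡ + 1
  even-[-3] m = trans (even-triple (- + 3) m) (trans (lemma (odd (+ 0) m) (even (+ 0) m)) (even-0 m))
    where
    lemma : ∀ c b → b - (- + 3) * (+ 3 + (- + 3)) * c ≡ b
    lemma = solve-∀
    even-0 : ∀ m → even (+ 0) m ≡ + 1
    even-0 zero    = refl
    even-0 (suc m) = trans (+-identityʳ _) (even-0 m)

  odd-[-3] : ∀ m → odd (- + 3) (m ℕ.+ (m ℕ.+ m)) ≡ + 0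
  odd-[-3] m = odd-triple (- + 3) m

  -- At k = m the right side of the ratio vanishes. With `evenCoef-diag` this makes the leading
  -- coefficient of sin((2m+1)z)/sin z equal to 1.
  oddCoef-diag : ∀ m → oddCoef m m ≡ + 0
  oddCoef-diag m = *-cancelˡ-≡ (+ suc (m ℕ.+ m)) _ _
    (trans (lin₁ (+ 1) (oddCoef-ratio m m) (lemma (+ m) (oddCoef m m) (evenCoef m m))) (sym (*-zeroʳ (+ suc (m ℕ.+ m)))))
    where
    lemma : ∀ m c b → (+ 1 + (m + m)) * c - + 0 ≡ + 1 * ((+ 2 * m + + 1) * c - (m - m) * b)
    lemma = solve-∀

  evenCoef-diag : ∀ m → evenCoef m m ≡ + 1
  evenCoef-diag zero = refl
  evenCoef-diag (suc m) = begin
    evenCoef m (suc m) + (oddCoef m m + evenCoef m m) ≡⟨ cong₂ (λ u v → u + (v + evenCoef m m)) above (oddCoef-diag m) ⟩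
    + 0 + (+ 0 + evenCoef m m) ≡⟨ trans (+-identityˡ _) (+-identityˡ _) ⟩
    evenCoef m m ≡⟨ evenCoef-diag m ⟩
    + 1 ∎
    where
    open ≡-Reasoning
    lemma : ∀ m b c → (+ 2 + (m + m)) * b - + 0
          ≡ + 1 * ((+ 2 * m + + 2) * b - (m + m + + 1) * c) + (m + m + + 1) * (c - + 0)
    lemma = solve-∀
    above : evenCoef m (suc m) ≡ + 0
    above = *-cancelˡ-≡ (+ suc (suc (m ℕ.+ m))) _ _
      (trans (lin₂ (+ 1) (+ m + + m + + 1) (evenCoef-ratio m m) (oddCoef-diag m)
                (lemma (+ m) (evenCoef m (suc m)) (oddCoef m m)))
             (sym (*-zeroʳ (+ suc (suc (m ℕ.+ m))))))

  ^-distrib-* : ∀ x y n → (x * y) ^ n ≡ x ^ n * y ^ n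
  ^-distrib-* x y zero    = refl
  ^-distrib-* x y (suc n) = trans (cong (x * y *_) (^-distrib-* x y n)) (lemma x y (x ^ n) (y ^ n))
    where
    lemma : ∀ x y u v → x * y * (u * v) ≡ x * u * (y * v)
    lemma = solve-∀

  -- Division of polynomials by X - r

  -- Polynomials are coefficient vectors, constant term first.
  horner : ∀ {n} → Vec ℤ n → ℤ → ℤ
  horner []       x = + 0
  horner (c ∷ cs) x = c + x * horner cs x

  -- Synthetic division by X - r: the coefficients are the intermediate values of Horner's scheme at
  -- r, and the remainder P(r) is dropped.
  quotientBy : ∀ {n} → ℤ → Vec ℤ (suc n) → Vec ℤ n
  quotientBy r (c ∷ [])         = []
  quotientBy r (c ∷ cs@(_ ∷ _)) = horner cs r ∷ quotientBy r cs

  horner-quotientBy : ∀ {n} r (P : Vec ℤ (suc n)) x →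
    horner P x - horner P r ≡ (x - r) * horner (quotientBy r P) x
  horner-quotientBy r (c ∷ []) x = lemma c x r
    where
    lemma : ∀ c x r → c + x * + 0 - (c + r * + 0) ≡ (x - r) * + 0
    lemma = solve-∀
  horner-quotientBy r (c ∷ cs@(_ ∷ _)) x = lin₁ x (horner-quotientBy r cs x)
    (lemma c x r (horner cs x) (horner cs r) (horner (quotientBy r cs) x))
    where
    lemma : ∀ c x r u v w → c + x * u - (c + r * v) - (x - r) * (v + x * w) ≡ x * (u - v - (x - r) * w)
    lemma = solve-∀

  monomial : ∀ n → Vec ℤ (suc n)
  monomial zero    = + 1 ∷ []
  monomial (suc n) = + 0 ∷ monomial n

  horner-monomial : ∀ n x → horner (monomial n) x ≡ x ^ n
  horner-monomial zero    x = cong (_+_ (+ 1)) (*-zeroʳ x)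
  horner-monomial (suc n) x = trans (+-identityˡ _) (cong (x *_) (horner-monomial n x))

  -- Arithmetic modulo a prime

  module Congruence (p : ℕ) (p-prime : Prime p) where

    infix 4 _≈_ _≉_
    -- The quotient is kept as data, so that a linear combination of congruences is certified by one
    -- ring identity, as in `by₁` to `by₄`.
    record _≈_ (x y : ℤ) : Set where
      constructor modulo
      field
        quotient : ℤ
        equality : x - y ≡ quotient * + p

    _≉_ : ℤ → ℤ → Set
    x ≉ y = ¬ x ≈ y

    ≡⇒≈ : ∀ {x y} → x ≡ y → x ≈ y
    ≡⇒≈ {x} refl = modulo (+ 0) (lemma x (+ p))
      where
      lemma : ∀ x p → x - x ≡ + 0 * p
      lemma = solve-∀

    by₁ : ∀ {x y a b} k → a ≈ b → x - y ≡ k * (a - b) → x ≈ y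
    by₁ k (modulo q eq) h = modulo (k * q) (trans h (trans (cong (k *_) eq) (lemma k q (+ p))))
      where
      lemma : ∀ k q p → k * (q * p) ≡ k * q * p
      lemma = solve-∀

    by₂ : ∀ {x y a b c d} k l → a ≈ b → c ≈ d → x - y ≡ k * (a - b) + l * (c - d) → x ≈ y
    by₂ k l (modulo q eq) (modulo r eq′) h =
      modulo (k * q + l * r) (trans h (trans (cong₂ (λ u v → k * u + l * v) eq eq′) (lemma k l q r (+ p))))
      where
      lemma : ∀ k l q r p → k * (q * p) + l * (r * p) ≡ (k * q + l * r) * p
      lemma = solve-∀

    by₃ : ∀ {x y a b c d e f} k l n → a ≈ b → c ≈ d → e ≈ f →
          x - y ≡ k * (a - b) + l * (c - d) + n * (e - f) → x ≈ y
    by₃ {a = a} {b} {c} {d} {e} {f} k l n h₁ h₂ h₃ eq = by₂ {a = k * a + l * c} {k * b + l * d} (+ 1) n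
      (by₂ k l h₁ h₂ (lemma k l a b c d)) h₃ (trans eq (lemma′ k l n a b c d e f))
      where
      lemma : ∀ k l a b c d → k * a + l * c - (k * b + l * d) ≡ k * (a - b) + l * (c - d)
      lemma = solve-∀
      lemma′ : ∀ k l n a b c d e f → k * (a - b) + l * (c - d) + n * (e - f)
             ≡ + 1 * (k * a + l * c - (k * b + l * d)) + n * (e - f)
      lemma′ = solve-∀

    by₄ : ∀ {x y a b c d e f g h} k l n o → a ≈ b → c ≈ d → e ≈ f → g ≈ h →
          x - y ≡ k * (a - b) + l * (c - d) + n * (e - f) + o * (g - h) → x ≈ y
    by₄ {a = a} {b} {c} {d} {e} {f} {g} {h} k l n o h₁ h₂ h₃ h₄ eq =
      by₃ {a = k * a + l * c} {k * b + l * d} (+ 1) n o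
      (by₂ k l h₁ h₂ (lemma k l a b c d)) h₃ h₄ (trans eq (lemma′ k l n o a b c d e f g h))
      where
      lemma : ∀ k l a b c d → k * a + l * c - (k * b + l * d) ≡ k * (a - b) + l * (c - d)
      lemma = solve-∀
      lemma′ : ∀ k l n o a b c d e f g h → k * (a - b) + l * (c - d) + n * (e - f) + o * (g - h)
             ≡ + 1 * (k * a + l * c - (k * b + l * d)) + n * (e - f) + o * (g - h)
      lemma′ = solve-∀

    ≈-refl : ∀ {x} → x ≈ x
    ≈-refl = ≡⇒≈ refl

    ≈-sym : ∀ {x y} → x ≈ y → y ≈ x
    ≈-sym {x} {y} h = by₁ (- + 1) h (lemma x y)
      where
      lemma : ∀ x y → y - x ≡ - + 1 * (x - y)
      lemma = solve-∀

    ≈-trans : ∀ {x y z} → x ≈ y → y ≈ z → x ≈ z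
    ≈-trans {x} {y} {z} h h′ = by₂ (+ 1) (+ 1) h h′ (lemma x y z)
      where
      lemma : ∀ x y z → x - z ≡ + 1 * (x - y) + + 1 * (y - z)
      lemma = solve-∀

    +-cong : ∀ {x y u v} → x ≈ y → u ≈ v → x + u ≈ y + v
    +-cong {x} {y} {u} {v} h h′ = by₂ (+ 1) (+ 1) h h′ (lemma x y u v)
      where
      lemma : ∀ x y u v → x + u - (y + v) ≡ + 1 * (x - y) + + 1 * (u - v)
      lemma = solve-∀

    *-cong : ∀ {x y u v} → x ≈ y → u ≈ v → x * u ≈ y * v
    *-cong {x} {y} {u} {v} h h′ = by₂ u y h h′ (lemma x y u v)
      where
      lemma : ∀ x y u v → x * u - y * v ≡ u * (x - y) + y * (u - v)
      lemma = solve-∀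

    ^-cong : ∀ {x y} n → x ≈ y → x ^ n ≈ y ^ n
    ^-cong zero    h = ≈-refl
    ^-cong (suc n) h = *-cong h (^-cong n h)

    sum-≈ : ∀ n {f g} → (∀ k → k ℕ.≤ n → f k ≈ g k) → sum n f ≈ sum n g
    sum-≈ zero    h = h 0 z≤n
    sum-≈ (suc n) h = +-cong (sum-≈ n (λ k k≤n → h k (ℕ.m≤n⇒m≤1+n k≤n))) (h (suc n) ℕ.≤-refl)

    p∣⇒≈0 : ∀ {x} → p ℕ.∣ ∣ x ∣ → x ≈ + 0
    p∣⇒≈0 {x} h with ∣ᵤ⇒∣ {+ p} {x} h
    ... | divides q eq = modulo q (trans (+-identityʳ x) eq)

    ≈0⇒p∣ : ∀ {x} → x ≈ + 0 → p ℕ.∣ ∣ x ∣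
    ≈0⇒p∣ {x} (modulo q eq) = ∣⇒∣ᵤ {+ p} {x} (divides q (trans (sym (+-identityʳ x)) eq))

    diff≈0 : ∀ {x y} → x ≈ y → x - y ≈ + 0
    diff≈0 (modulo q eq) = modulo q (trans (+-identityʳ _) eq)

    diff≈0⁻¹ : ∀ {x y} → x - y ≈ + 0 → x ≈ y
    diff≈0⁻¹ (modulo q eq) = modulo q (trans (sym (+-identityʳ _)) eq)

    *-≈0 : ∀ x y → x * y ≈ + 0 → x ≈ + 0 ⊎ y ≈ + 0
    *-≈0 x y h with euclidsLemma ∣ x ∣ ∣ y ∣ p-prime (subst (p ℕ.∣_) (abs-* x y) (≈0⇒p∣ h))
    ... | inj₁ h′ = inj₁ (p∣⇒≈0 h′)
    ... | inj₂ h′ = inj₂ (p∣⇒≈0 h′)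

    *-≉0 : ∀ {x y} → x ≉ + 0 → y ≉ + 0 → x * y ≉ + 0
    *-≉0 {x} {y} hx hy h with *-≈0 x y h
    ... | inj₁ h′ = hx h′
    ... | inj₂ h′ = hy h′

    *-cancelˡ : ∀ d {x y} → d ≉ + 0 → d * x ≈ d * y → x ≈ y
    *-cancelˡ d {x} {y} hd h =
      diff≈0⁻¹ ([ (λ h′ → contradiction h′ hd) , (λ h′ → h′) ]′ (*-≈0 d (x - y) (by₁ (+ 1) h (lemma d x y))))
      where
      lemma : ∀ d x y → d * (x - y) - + 0 ≡ + 1 * (d * x - d * y)
      lemma = solve-∀

    0<n<p⇒≉0 : ∀ {n} → 0 ℕ.< n → n ℕ.< p → + n ≉ + 0
    0<n<p⇒≉0 {suc n} _ n<p h = ℕ.>⇒∤ n<p (≈0⇒p∣ h)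

    1≉0 : + 1 ≉ + 0
    1≉0 = 0<n<p⇒≉0 (s≤s z≤n) (ℕ.nonTrivial⇒n>1 p {{prime⇒nonTrivial p-prime}})

    -- Lagrange's bound on the number of roots: after division by X - root 0 the quotient vanishes
    -- at the remaining roots, because p is prime and they are incongruent to `root 0`.
    roots⇒horner≈0 : ∀ {n} (P : Vec ℤ n) (root : ℕ → ℤ) →
      (∀ i j → i ℕ.< j → j ℕ.< n → root i ≉ root j) →
      (∀ i → i ℕ.< n → horner P (root i) ≈ + 0) → ∀ x → horner P x ≈ + 0
    roots⇒horner≈0 [] root distinct vanish x = ≈-refl
    roots⇒horner≈0 {suc n} P root distinct vanish x =
      by₃ (+ 1) (x - root 0) (+ 1) (≡⇒≈ (horner-quotientBy (root 0) P x))
        (roots⇒horner≈0 Q (λ i → root (suc i)) (λ i j i<j j<n → distinct (suc i) (suc j) (s<s i<j) (s<s j<n)) vanish′ x)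
        (vanish 0 z<s) (lemma (horner P x) (horner P (root 0)) (x - root 0) (horner Q x))
      where
      Q = quotientBy (root 0) P
      lemma : ∀ u v w q → u - + 0 ≡ + 1 * (u - v - w * q) + w * (q - + 0) + + 1 * (v - + 0)
      lemma = solve-∀
      vanish′ : ∀ i → i ℕ.< n → horner Q (root (suc i)) ≈ + 0
      vanish′ i i<n =
        [ (λ h → contradiction (≈-sym (diff≈0⁻¹ h)) (distinct 0 (suc i) z<s (s<s i<n))) , (λ h → h) ]′
        (*-≈0 (root (suc i) - root 0) (horner Q (root (suc i)))
          (by₃ (- + 1) (+ 1) (- + 1) (≡⇒≈ (horner-quotientBy (root 0) P (root (suc i))))
            (vanish (suc i) (s<s i<n)) (vanish 0 z<s)
            (lemma′ (horner P (root (suc i))) (horner P (root 0)) ((root (suc i) - root 0) * horner Q (root (suc i))))))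
        where
        lemma′ : ∀ u v w → w - + 0 ≡ - + 1 * (u - v - w) + + 1 * (u - + 0) + - + 1 * (v - + 0)
        lemma′ = solve-∀

  T-does : ∀ {A : Set} (d : Dec A) → T (does d) → A
  T-does (yes a) _ = a

  does-T : ∀ {A : Set} (d : Dec A) → A → T (does d)
  does-T (yes _) _ = _
  does-T (no ¬a) a = ⊥-elim (¬a a)

  -- Fermat's theorem and Euler's criterion for p = 2N+1

  module OddPrime (N : ℕ) (p-prime : Prime (suc (N ℕ.+ N))) (3<p : 3 ℕ.< suc (N ℕ.+ N)) where

    p : ℕ
    p = suc (N ℕ.+ N)

    open Congruence p p-prime public

    p≈0 : + p ≈ + 0
    p≈0 = modulo (+ 1) (lemma (+ p))
      where
      lemma : ∀ p → p - + 0 ≡ + 1 * p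
      lemma = solve-∀

    2≉0 : + 2 ≉ + 0
    2≉0 = 0<n<p⇒≉0 z<s (ℕ.<-trans (s<s (s<s z<s)) 3<p)

    3≉0 : + 3 ≉ + 0
    3≉0 = 0<n<p⇒≉0 z<s 3<p

    4≉0 : + 4 ≉ + 0
    4≉0 = *-≉0 2≉0 2≉0

    odd≉0 : ∀ {k} → k ℕ.< N → + 2 * + k + + 1 ≉ + 0
    odd≉0 {k} k<N h = 0<n<p⇒≉0 {suc (k ℕ.+ k)} z<s (s<s (ℕ.+-mono-< k<N k<N)) (≈-trans (≡⇒≈ (lemma (+ k))) h)
      where
      lemma : ∀ k → + 1 + (k + k) ≡ + 2 * k + + 1
      lemma = solve-∀

    sum≈last : ∀ n f → (∀ k → k ℕ.< n → f k ≈ + 0) → sum n f ≈ f n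
    sum≈last zero    f h = ≈-refl
    sum≈last (suc n) f h = ≈-trans
      (+-cong (≈-trans (sum-≈ n (λ k k≤n → h k (s≤s k≤n))) (≡⇒≈ (sum-0 n))) ≈-refl)
      (≡⇒≈ (+-identityˡ (f (suc n))))

    -- By `sinCoef-even`, 2k+1 times the coefficient is a multiple of 2N+1 = p, and 2k+1 is a unit
    -- for k < N.
    sinCoef≈0 : ∀ k → k ℕ.< N → sinCoef N k ≈ + 0
    sinCoef≈0 k k<N = [ (λ h → contradiction h (odd≉0 k<N)) , (λ h → h) ]′ (*-≈0 (+ 2 * + k + + 1) (sinCoef N k)
      (by₂ (+ 1) (evenCoef N k) (≡⇒≈ (sinCoef-even N k)) p≈0
        (lemma (+ N) ((+ 2 * + k + + 1) * sinCoef N k) (evenCoef N k))))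
      where
      lemma : ∀ n s b → s - + 0 ≡ + 1 * (s - (+ 2 * n + + 1) * b) + b * (+ 1 + (n + n) - + 0)
      lemma = solve-∀

    -- Modulo p only the leading term of sin(pw)/sin w survives, and its coefficient is 1.
    sine≈ : ∀ y → sine y N ≈ y ^ N
    sine≈ y = ≈-trans (≡⇒≈ (trans (sym (eval-sinCoef N 0 y)) (cong (λ n → eval n (sinCoef N) y) (ℕ.+-identityʳ N))))
      (≈-trans
        (sum≈last N (λ k → sinCoef N k * y ^ k) (λ k k<N →
          ≈-trans (*-cong (sinCoef≈0 k k<N) (≈-refl {y ^ k})) (≡⇒≈ (*-zeroˡ (y ^ k)))))
        (≡⇒≈ (trans (cong₂ (λ b c → (b + + 2 * c) * y ^ N) (evenCoef-diag N) (oddCoef-diag N)) (*-identityˡ (y ^ N)))))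

    -- The reflection y ↦ -4-y carries `sine≈` to the cosine quotient; the signs (-1)^N on the two
    -- sides cancel.
    even≈ : ∀ y → even y N ≈ (+ 4 + y) ^ N
    even≈ y = by₃ (- even y N) s ((+ 4 + y) ^ N) (≡⇒≈ s²≡1) step (≡⇒≈ s²≡1)
      (lemma s (even y N) ((+ 4 + y) ^ N))
      where
      s = (- + 1) ^ N
      s²≡1 : s * s ≡ + 1
      s²≡1 = trans (sym (^-distrib-* (- + 1) (- + 1) N)) (^-zeroˡ N)
      neg : ∀ y → - + 4 - y ≡ - + 1 * (+ 4 + y)
      neg = solve-∀
      step : s * even y N ≈ s * (+ 4 + y) ^ N
      step = ≈-trans (≡⇒≈ (sym (sine-reflect y N))) (≈-trans (sine≈ (- + 4 - y))
        (≡⇒≈ (trans (cong (_^ N) (neg y)) (^-distrib-* (- + 1) (+ 4 + y) N))))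
      lemma : ∀ s b β → b - β ≡ - b * (s * s - + 1) + s * (s * b - s * β) + β * (s * s - + 1)
      lemma = solve-∀

    -- The power y^p, written with y^N because Legendre symbols enter as N-th powers.
    frob : ℤ → ℤ
    frob y = y * (y ^ N * y ^ N)

    -- cos² + sin² = 1 at the angle pw; this replaces the binomial theorem in the proof of Fermat's theorem.
    frob-+4 : ∀ y → frob (+ 4 + y) ≈ frob y + + 4
    frob-+4 y = by₃ (+ 4) (- ((+ 4 + y) * (β + b))) (y * (γ + (b + + 2 * c)))
      (≡⇒≈ (even²-odd² y N)) (even≈ y) (sine≈ y) (lemma y β γ b c)
      where
      β = (+ 4 + y) ^ N
      γ = y ^ N
      b = even y N
      c = odd y N
      lemma : ∀ y β γ b c → (+ 4 + y) * (β * β) - (y * (γ * γ) + + 4)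
            ≡ + 4 * (b * b - y * b * c - y * c * c - + 1) + - ((+ 4 + y) * (β + b)) * (b - β)
            + y * (γ + (b + + 2 * c)) * (b + + 2 * c - γ)
      lemma = solve-∀

    frob-cong : ∀ {x y} → x ≈ y → frob x ≈ frob y
    frob-cong h = *-cong h (*-cong (^-cong N h) (^-cong N h))

    frob-4* : ∀ n → frob (+ 4 * + n) ≈ + 4 * + n
    frob-4* zero    = ≡⇒≈ (*-zeroˡ ((+ 0) ^ N * (+ 0) ^ N))
    frob-4* (suc n) = ≈-trans (≡⇒≈ (cong frob (lemma (+ n)))) (≈-trans (frob-+4 (+ 4 * + n))
      (≈-trans (+-cong (frob-4* n) ≈-refl) (≡⇒≈ (lemma′ (+ n)))))
      where
      lemma : ∀ n → + 4 * (+ 1 + n) ≡ + 4 + + 4 * n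
      lemma = solve-∀
      lemma′ : ∀ n → + 4 * n + + 4 ≡ + 4 * (+ 1 + n)
      lemma′ = solve-∀

    frob-* : ∀ x y → frob (x * y) ≡ frob x * frob y
    frob-* x y = trans (cong (λ z → x * y * (z * z)) (^-distrib-* x y N)) (lemma x y (x ^ N) (y ^ N))
      where
      lemma : ∀ x y u v → x * y * (u * v * (u * v)) ≡ x * (u * u) * (y * (v * v))
      lemma = solve-∀

    -- Since `frob-+4` advances in steps of 4, it settles multiples of 4 only; multiplicativity
    -- together with frob 4 ≈ 4 then removes the 4.
    fermatℕ : ∀ n → frob (+ n) ≈ + n
    fermatℕ n = *-cancelˡ (+ 4) 4≉0
      (by₃ (- frob (+ n)) (+ 1) (- + 1) (frob-4* 1) (frob-4* n) (≡⇒≈ (frob-* (+ 4) (+ n)))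
        (lemma (frob (+ 4)) (frob (+ n)) (frob (+ 4 * + n)) (+ n)))
      where
      lemma : ∀ f g h n → + 4 * g - + 4 * n ≡ - g * (f - + 4) + + 1 * (h - + 4 * n) + - + 1 * (h - f * g)
      lemma = solve-∀

    fermat : ∀ z → frob z ≈ z
    fermat (+ n)    = fermatℕ n
    -- The negative number -(n+1) is congruent to the natural number (n+1)(p-1).
    fermat -[1+ n ] = ≈-trans (frob-cong (≈-sym natural)) (≈-trans (fermatℕ (suc n ℕ.* (N ℕ.+ N))) natural)
      where
      lemma : ∀ n m → (+ 1 + n) * (m + m) - (- (+ 1 + n)) ≡ (+ 1 + n) * (+ 1 + (m + m) - + 0)
      lemma = solve-∀
      natural : + (suc n ℕ.* (N ℕ.+ N)) ≈ -[1+ n ]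
      natural = ≈-trans (≡⇒≈ (pos-* (suc n) (N ℕ.+ N))) (by₁ (+ suc n) p≈0 (lemma (+ n) (+ N)))

    fermat-unit : ∀ {z} → z ≉ + 0 → z ^ N * z ^ N ≈ + 1
    fermat-unit {z} hz = *-cancelˡ z hz (≈-trans (fermat z) (≡⇒≈ (sym (*-identityʳ z))))

    ^N≈0 : ∀ {z} → z ≈ + 0 → z ^ N ≈ + 0
    ^N≈0 {z} h = go N (λ { refl → contradiction 3<p λ { (s≤s ()) } })
      where
      go : ∀ n → n ≢ 0 → z ^ n ≈ + 0
      go zero    n≢0 = contradiction refl n≢0
      go (suc n) _   = ≈-trans (*-cong h ≈-refl) (≡⇒≈ (*-zeroˡ (z ^ n)))

    -- The inverse is z^(p-2).
    inverse : ∀ {z} → z ≉ + 0 → ∃ λ w → z * w ≈ + 1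
    inverse {z} hz = go N (λ { refl → contradiction 3<p λ { (s≤s ()) } }) (fermat-unit hz)
      where
      lemma : ∀ z u → z * (u * (z * u)) ≡ z * u * (z * u)
      lemma = solve-∀
      go : ∀ n → n ≢ 0 → z ^ n * z ^ n ≈ + 1 → ∃ λ w → z * w ≈ + 1
      go zero    n≢0 h = contradiction refl n≢0
      go (suc n) _   h = z ^ n * (z * z ^ n) , ≈-trans (≡⇒≈ (lemma z (z ^ n))) h

    isSquareMod⇒ : ∀ a → T (isSquareMod p a) → ∃ λ x → + x * + x ≈ a
    isSquareMod⇒ a h with find (any⁻ _ (upTo p) h)
    ... | x , _ , h′ = x , diff≈0⁻¹ (p∣⇒≈0 (T-does (p ℕ.∣? ∣ + x * + x - a ∣) h′))

    ⇒isSquareMod : ∀ a x → x ℕ.< p → + x * + x ≈ a → T (isSquareMod p a)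
    ⇒isSquareMod a x x<p h = any⁺ (λ x → does (p ℕ.∣? ∣ + x * + x - a ∣))
      (lose (∈-upTo⁺ x<p) (does-T (p ℕ.∣? ∣ + x * + x - a ∣) (≈0⇒p∣ (diff≈0 h))))

    square⇒^N≈1 : ∀ {a x} → a ≉ + 0 → x * x ≈ a → a ^ N ≈ + 1
    square⇒^N≈1 {a} {x} ha h = ≈-trans (^-cong N (≈-sym h)) (≈-trans (≡⇒≈ (^-distrib-* x x N))
      (fermat-unit (λ x≈0 → ha (≈-trans (≈-sym h) (≈-trans (*-cong x≈0 x≈0) ≈-refl)))))

    -- The N nonzero squares exhaust the roots of X^N - 1.
    nonsquare⇒^N≉1 : ∀ {a} → (∀ x → x ℕ.< p → + x * + x ≉ a) → a ^ N ≉ + 1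
    nonsquare⇒^N≉1 {a} nonsquare a^N≈1 = go N refl
      where
      -- Index 0 holds the alleged additional root `a`; it is followed by 1², ..., N².
      root : ℕ → ℤ
      root zero    = a
      root (suc k) = + suc k * + suc k
      <N⇒<p : ∀ {k} → k ℕ.≤ N → k ℕ.< p
      <N⇒<p k≤N = s≤s (ℕ.≤-trans k≤N (ℕ.m≤m+n N N))
      distinct : ∀ i j → i ℕ.< j → j ℕ.< suc N → root i ≉ root j
      distinct zero    (suc j) i<j (s≤s j≤N) h = nonsquare (suc j) (<N⇒<p j≤N) (≈-sym h)
      -- If two of the squares agreed, p would divide the difference or the sum of their bases, and
      -- both lie strictly between 0 and p.
      distinct (suc i) (suc j) i<j (s≤s j≤N) h =
        [ 0<n<p⇒≉0 {d} (ℕ.m<n⇒0<n∸m i<j) (<N⇒<p (ℕ.≤-trans (ℕ.m∸n≤m (suc j) (suc i)) j≤N))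
        , 0<n<p⇒≉0 {suc i ℕ.+ suc j} z<s (s≤s (ℕ.+-mono-≤ (ℕ.≤-trans (ℕ.<⇒≤ i<j) j≤N) j≤N)) ]′
        (*-≈0 (+ d) (+ suc i + + suc j) (by₁ (- + 1) h (trans
          (cong (λ z → + d * (+ suc i + + z) - + 0) (sym split))
          (trans (lemma (+ d) (+ suc i)) (cong (λ z → - + 1 * (+ suc i * + suc i - + z * + z)) split)))))
        where
        d = suc j ℕ.∸ suc i
        split : d ℕ.+ suc i ≡ suc j
        split = ℕ.m∸n+n≡m (ℕ.<⇒≤ i<j)
        lemma : ∀ d i → d * (i + (d + i)) - + 0 ≡ - + 1 * (i * i - (d + i) * (d + i))
        lemma = solve-∀
      vanish : ∀ i → i ℕ.< suc N → root i ^ N ≈ + 1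
      vanish zero    _         = a^N≈1
      vanish (suc i) (s≤s i≤N) = square⇒^N≈1 {x = + suc i} (*-≉0 unit unit) ≈-refl
        where
        unit : + suc i ≉ + 0
        unit = 0<n<p⇒≉0 z<s (<N⇒<p i≤N)
      go : ∀ n → n ≡ N → ⊥
      go zero    refl = contradiction 3<p λ { (s≤s ()) }
      -- X^N - 1 has N+1 coefficients and N+1 incongruent roots, so it would vanish at 0 as well,
      -- where its value is -1.
      go (suc n) refl = 1≉0 (by₁ (- + 1) (roots⇒horner≈0 (- + 1 ∷ monomial n) root distinct
          (λ i i<n → by₂ (+ 1) (root i) (vanish i i<n) (≡⇒≈ (horner-monomial n (root i)))
            (lemma (root i) (root i ^ n) (horner (monomial n) (root i))))
          (+ 0)) (lemma′ (horner (monomial n) (+ 0))))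
        where
        lemma : ∀ r u v → - + 1 + r * v - + 0 ≡ + 1 * (r * u - + 1) + r * (v - u)
        lemma = solve-∀
        lemma′ : ∀ v → + 1 - + 0 ≡ - + 1 * (- + 1 + + 0 * v - + 0)
        lemma′ = solve-∀

    nonsquare⇒^N≈-1 : ∀ {a} → a ≉ + 0 → (∀ x → x ℕ.< p → + x * + x ≉ a) → a ^ N ≈ - + 1
    nonsquare⇒^N≈-1 {a} ha nonsquare =
      [ (λ h → contradiction (diff≈0⁻¹ h) (nonsquare⇒^N≉1 nonsquare)) , diff≈0⁻¹ ]′
      (*-≈0 (a ^ N - + 1) (a ^ N - - + 1) (by₁ (+ 1) (fermat-unit ha) (lemma (a ^ N))))
      where
      lemma : ∀ u → (u - + 1) * (u - - + 1) - + 0 ≡ + 1 * (u * u - + 1)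
      lemma = solve-∀

    euler : ∀ a → legendreℤ a p ≈ a ^ N
    euler a = cases (does (p ℕ.∣? ∣ a ∣)) (isSquareMod p a)
      (λ h → ≈-sym (^N≈0 (p∣⇒≈0 (T-does (p ℕ.∣? ∣ a ∣) h))))
      (λ h h′ → ≈-sym (square⇒^N≈1 {x = + proj₁ (isSquareMod⇒ a h′)} (unit h) (proj₂ (isSquareMod⇒ a h′))))
      (λ h h′ → ≈-sym (nonsquare⇒^N≈-1 (unit h) (λ x x<p x² → h′ (⇒isSquareMod a x x<p x²))))
      where
      unit : ¬ T (does (p ℕ.∣? ∣ a ∣)) → a ≉ + 0
      unit h a≈0 = h (does-T (p ℕ.∣? ∣ a ∣) (≈0⇒p∣ a≈0))
      cases : ∀ b c → (T b → + 0 ≈ a ^ N) → (¬ T b → T c → + 1 ≈ a ^ N) → (¬ T b → ¬ T c → - + 1 ≈ a ^ N) →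
        (if b then + 0 else (if c then + 1 else - + 1)) ≈ a ^ N
      cases true  c     h h′ h″ = h _
      cases false true  h h′ h″ = h′ (λ ()) _
      cases false false h h′ h″ = h″ (λ ()) (λ ())

  -- Rationals and their residues modulo p

  toℚᵘ-ℤ→ℚ : ∀ z → toℚᵘ (ℤ→ℚ z) ℚᵘ.≃ mkℚᵘ z 0
  toℚᵘ-ℤ→ℚ z = ℚ.toℚᵘ-fromℚᵘ (mkℚᵘ z 0)

  ℤ→ℚ-+ : ∀ a b → ℤ→ℚ (a + b) ≡ ℤ→ℚ a ℚ.+ ℤ→ℚ b
  ℤ→ℚ-+ a b = ℚ.toℚᵘ-injective (begin
    toℚᵘ (ℤ→ℚ (a + b))               ≈⟨ toℚᵘ-ℤ→ℚ (a + b) ⟩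
    mkℚᵘ (a + b) 0                   ≈⟨ *≡* (lemma a b) ⟩
    mkℚᵘ a 0 ℚᵘ.+ mkℚᵘ b 0           ≈⟨ ℚᵘ.+-cong (toℚᵘ-ℤ→ℚ a) (toℚᵘ-ℤ→ℚ b) ⟨
    toℚᵘ (ℤ→ℚ a) ℚᵘ.+ toℚᵘ (ℤ→ℚ b)   ≈⟨ ℚ.toℚᵘ-homo-+ (ℤ→ℚ a) (ℤ→ℚ b) ⟨
    toℚᵘ (ℤ→ℚ a ℚ.+ ℤ→ℚ b)           ∎)
    where
    open import Relation.Binary.Reasoning.Setoid ℚᵘ.≃-setoid
    lemma : ∀ a b → (a + b) * + 1 ≡ (a * + 1 + b * + 1) * + 1
    lemma = solve-∀

  ℤ→ℚ-* : ∀ a b → ℤ→ℚ (a * b) ≡ ℤ→ℚ a ℚ.* ℤ→ℚ b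
  ℤ→ℚ-* a b = ℚ.toℚᵘ-injective (begin
    toℚᵘ (ℤ→ℚ (a * b))               ≈⟨ toℚᵘ-ℤ→ℚ (a * b) ⟩
    mkℚᵘ (a * b) 0                   ≈⟨ ℚᵘ.*-cong (toℚᵘ-ℤ→ℚ a) (toℚᵘ-ℤ→ℚ b) ⟨
    toℚᵘ (ℤ→ℚ a) ℚᵘ.* toℚᵘ (ℤ→ℚ b)   ≈⟨ ℚ.toℚᵘ-homo-* (ℤ→ℚ a) (ℤ→ℚ b) ⟨
    toℚᵘ (ℤ→ℚ a ℚ.* ℤ→ℚ b)           ∎)
    where open import Relation.Binary.Reasoning.Setoid ℚᵘ.≃-setoid

  ℤ→ℚ-neg : ∀ a → ℤ→ℚ (- a) ≡ ℚ.- ℤ→ℚ a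
  ℤ→ℚ-neg a = ℚ.toℚᵘ-injective (begin
    toℚᵘ (ℤ→ℚ (- a))     ≈⟨ toℚᵘ-ℤ→ℚ (- a) ⟩
    mkℚᵘ (- a) 0         ≈⟨ ℚᵘ.-‿cong (toℚᵘ-ℤ→ℚ a) ⟨
    ℚᵘ.- toℚᵘ (ℤ→ℚ a)    ≈⟨ ℚ.toℚᵘ-homo‿- (ℤ→ℚ a) ⟨
    toℚᵘ (ℚ.- ℤ→ℚ a)     ∎)
    where open import Relation.Binary.Reasoning.Setoid ℚᵘ.≃-setoid

  ℤ→ℚ-injective : ∀ {a b} → ℤ→ℚ a ≡ ℤ→ℚ b → a ≡ b
  ℤ→ℚ-injective {a} {b} eq with ℚᵘ.≃-trans (ℚᵘ.≃-sym (toℚᵘ-ℤ→ℚ a)) (ℚᵘ.≃-trans (ℚᵘ.≃-reflexive (cong toℚᵘ eq)) (toℚᵘ-ℤ→ℚ b))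
  ... | *≡* h = trans (sym (*-identityʳ a)) (trans h (*-identityʳ b))

  *-denominator : ∀ q → q ℚ.* ℤ→ℚ (+ ↧ₙ q) ≡ ℤ→ℚ (↥ q)
  *-denominator q@(mkℚ n d-1 _) = ℚ.toℚᵘ-injective (begin
    toℚᵘ (q ℚ.* ℤ→ℚ (+ suc d-1))                ≈⟨ ℚ.toℚᵘ-homo-* q (ℤ→ℚ (+ suc d-1)) ⟩
    toℚᵘ q ℚᵘ.* toℚᵘ (ℤ→ℚ (+ suc d-1))          ≈⟨ ℚᵘ.*-cong (ℚᵘ.≃-refl {toℚᵘ q}) (toℚᵘ-ℤ→ℚ (+ suc d-1)) ⟩
    mkℚᵘ n d-1 ℚᵘ.* mkℚᵘ (+ suc d-1) 0          ≈⟨ *≡* (trans (*-identityʳ _) (cong (λ d → n * + d) (sym (ℕ.*-identityʳ (suc d-1))))) ⟩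
    mkℚᵘ n 0                                    ≈⟨ toℚᵘ-ℤ→ℚ n ⟨
    toℚᵘ (ℤ→ℚ n)                                ∎)
    where open import Relation.Binary.Reasoning.Setoid ℚᵘ.≃-setoid

  cross-+ : ∀ q q′ d d′ → (q ℚ.+ q′) ℚ.* (d ℚ.* d′) ≡ q ℚ.* d ℚ.* d′ ℚ.+ q′ ℚ.* d′ ℚ.* d
  cross-+ = solve 4 (λ q q′ d d′ → (q :+ q′) :* (d :* d′) := q :* d :* d′ :+ q′ :* d′ :* d) refl
  cross-* : ∀ q q′ d d′ → (q ℚ.* q′) ℚ.* (d ℚ.* d′) ≡ q ℚ.* d ℚ.* (q′ ℚ.* d′)
  cross-* = solve 4 (λ q q′ d d′ → (q :* q′) :* (d :* d′) := q :* d :* (q′ :* d′)) refl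

  module Reduction (N : ℕ) (p-prime : Prime (suc (N ℕ.+ N))) (3<p : 3 ℕ.< suc (N ℕ.+ N)) where
    open OddPrime N p-prime 3<p

    -- q ~ z: the rational q is p-integral and reduces to z modulo p.
    infix 4 _~_
    record _~_ (q : ℚ) (z : ℤ) : Set where
      constructor reduces
      field
        den num    : ℤ
        den≉0      : den ≉ + 0
        q*den≡num  : q ℚ.* ℤ→ℚ den ≡ ℤ→ℚ num
        num≈z*den  : num ≈ z * den

    ~-resp-≈ : ∀ {q z w} → q ~ z → z ≈ w → q ~ w
    ~-resp-≈ (reduces d n hd eq h) z≈w = reduces d n hd eq (≈-trans h (*-cong z≈w ≈-refl))

    ~-ℤ : ∀ z → ℤ→ℚ z ~ z
    ~-ℤ z = reduces (+ 1) z 1≉0 (ℚ.*-identityʳ (ℤ→ℚ z)) (≡⇒≈ (sym (*-identityʳ z)))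

    ~-+ : ∀ {q r z w} → q ~ z → r ~ w → q ℚ.+ r ~ z + w
    ~-+ {q} {r} {z} {w} (reduces d n hd eq h) (reduces d′ n′ hd′ eq′ h′) =
      reduces (d * d′) (n * d′ + n′ * d) (*-≉0 hd hd′)
        (begin
          (q ℚ.+ r) ℚ.* ℤ→ℚ (d * d′) ≡⟨ cong ((q ℚ.+ r) ℚ.*_) (ℤ→ℚ-* d d′) ⟩
          (q ℚ.+ r) ℚ.* (ℤ→ℚ d ℚ.* ℤ→ℚ d′) ≡⟨ cross-+ q r (ℤ→ℚ d) (ℤ→ℚ d′) ⟩
          q ℚ.* ℤ→ℚ d ℚ.* ℤ→ℚ d′ ℚ.+ r ℚ.* ℤ→ℚ d′ ℚ.* ℤ→ℚ d ≡⟨ cong₂ (λ u v → u ℚ.* ℤ→ℚ d′ ℚ.+ v ℚ.* ℤ→ℚ d) eq eq′ ⟩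
          ℤ→ℚ n ℚ.* ℤ→ℚ d′ ℚ.+ ℤ→ℚ n′ ℚ.* ℤ→ℚ d ≡⟨ cong₂ ℚ._+_ (ℤ→ℚ-* n d′) (ℤ→ℚ-* n′ d) ⟨
          ℤ→ℚ (n * d′) ℚ.+ ℤ→ℚ (n′ * d) ≡⟨ ℤ→ℚ-+ (n * d′) (n′ * d) ⟨
          ℤ→ℚ (n * d′ + n′ * d) ∎)
        (by₂ d′ d h h′ (lemma n n′ d d′ z w))
      where
      open ≡-Reasoning
      lemma : ∀ n n′ d d′ z w → n * d′ + n′ * d - (z + w) * (d * d′) ≡ d′ * (n - z * d) + d * (n′ - w * d′)
      lemma = solve-∀

    ~-* : ∀ {q r z w} → q ~ z → r ~ w → q ℚ.* r ~ z * w
    ~-* {q} {r} {z} {w} (reduces d n hd eq h) (reduces d′ n′ hd′ eq′ h′) =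
      reduces (d * d′) (n * n′) (*-≉0 hd hd′)
        (begin
          (q ℚ.* r) ℚ.* ℤ→ℚ (d * d′) ≡⟨ cong ((q ℚ.* r) ℚ.*_) (ℤ→ℚ-* d d′) ⟩
          (q ℚ.* r) ℚ.* (ℤ→ℚ d ℚ.* ℤ→ℚ d′) ≡⟨ cross-* q r (ℤ→ℚ d) (ℤ→ℚ d′) ⟩
          q ℚ.* ℤ→ℚ d ℚ.* (r ℚ.* ℤ→ℚ d′) ≡⟨ cong₂ ℚ._*_ eq eq′ ⟩
          ℤ→ℚ n ℚ.* ℤ→ℚ n′ ≡⟨ ℤ→ℚ-* n n′ ⟨
          ℤ→ℚ (n * n′) ∎)
        (by₂ n′ (z * d) h h′ (lemma n n′ d d′ z w))
      where
      open ≡-Reasoning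
      lemma : ∀ n n′ d d′ z w → n * n′ - z * w * (d * d′) ≡ n′ * (n - z * d) + z * d * (n′ - w * d′)
      lemma = solve-∀

    ~-neg : ∀ {q z} → q ~ z → ℚ.- q ~ - z
    ~-neg {q} {z} (reduces d n hd eq h) = reduces d (- n) hd
      (trans (sym (ℚ.neg-distribˡ-* q (ℤ→ℚ d))) (trans (cong ℚ.-_ eq) (sym (ℤ→ℚ-neg n))))
      (by₁ (- + 1) h (lemma n z d))
      where
      lemma : ∀ n z d → - n - (- z) * d ≡ - + 1 * (n - z * d)
      lemma = solve-∀

    ~-^ : ∀ {q z} k → q ~ z → q ^ℚ k ~ z ^ k
    ~-^ zero    h = ~-ℤ (+ 1)
    ~-^ (suc k) h = ~-* h (~-^ k h)

    ~-cancel : ∀ {q r z w} d → d ≉ + 0 → q ℚ.* ℤ→ℚ d ≡ r → r ~ z → z ≈ w * d → q ~ w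
    ~-cancel {q} {r} {z} {w} d hd eq (reduces d′ n hd′ eq′ h) h′ = reduces (d * d′) n (*-≉0 hd hd′)
      (begin
        q ℚ.* ℤ→ℚ (d * d′)          ≡⟨ cong (q ℚ.*_) (ℤ→ℚ-* d d′) ⟩
        q ℚ.* (ℤ→ℚ d ℚ.* ℤ→ℚ d′)    ≡⟨ ℚ.*-assoc q (ℤ→ℚ d) (ℤ→ℚ d′) ⟨
        q ℚ.* ℤ→ℚ d ℚ.* ℤ→ℚ d′      ≡⟨ cong (ℚ._* ℤ→ℚ d′) eq ⟩
        r ℚ.* ℤ→ℚ d′                ≡⟨ eq′ ⟩
        ℤ→ℚ n                       ∎)
      (by₂ (+ 1) d′ h h′ (lemma n z d d′ w))
      where
      open ≡-Reasoning
      lemma : ∀ n z d d′ w → n - w * (d * d′) ≡ + 1 * (n - z * d′) + d′ * (z - w * d)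
      lemma = solve-∀

    ~-1/ : ∀ {q z w} .{{nz : ℚ.NonZero q}} → q ~ z → z * w ≈ + 1 → ℚ.1/ q ~ w
    ~-1/ {q} {z} {w} (reduces d n hd eq h) zw≈1 = reduces n d
      (λ n≈0 → hd (by₃ w (- w) (- d) n≈0 h zw≈1 (lemma n z d w)))
      (begin
        ℚ.1/ q ℚ.* ℤ→ℚ n              ≡⟨ cong (ℚ.1/ q ℚ.*_) eq ⟨
        ℚ.1/ q ℚ.* (q ℚ.* ℤ→ℚ d)      ≡⟨ ℚ.*-assoc (ℚ.1/ q) q (ℤ→ℚ d) ⟨
        ℚ.1/ q ℚ.* q ℚ.* ℤ→ℚ d        ≡⟨ cong (ℚ._* ℤ→ℚ d) (ℚ.*-inverseˡ q) ⟩
        1ℚ ℚ.* ℤ→ℚ d                  ≡⟨ ℚ.*-identityˡ (ℤ→ℚ d) ⟩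
        ℤ→ℚ d                         ∎)
      (by₂ (- w) (- d) h zw≈1 (lemma′ n z d w))
      where
      open ≡-Reasoning
      lemma : ∀ n z d w → d - + 0 ≡ w * (n - + 0) + - w * (n - z * d) + - d * (z * w - + 1)
      lemma = solve-∀
      lemma′ : ∀ n z d w → d - w * n ≡ - w * (n - z * d) + - d * (z * w - + 1)
      lemma′ = solve-∀

    ~-unit⇒≢0 : ∀ {q z} → z ≉ + 0 → q ~ z → q ≢ 0ℚ
    ~-unit⇒≢0 {z = z} hz (reduces d n hd eq h) refl = *-≉0 hz hd (≈-trans (≈-sym h) (≡⇒≈ n≡0))
      where
      n≡0 : n ≡ + 0
      n≡0 = ℤ→ℚ-injective (trans (sym eq) (ℚ.*-zeroˡ (ℤ→ℚ d)))

    ~-÷ : ∀ {q r z w w⁻¹} → q ~ z → r ~ w → w * w⁻¹ ≈ + 1 → q ÷ r ~ z * w⁻¹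
    ~-÷ {q} {r} {z} {w} {w⁻¹} hq hr inv with r ℚ.≟ 0ℚ
    ... | yes r≡0 = contradiction r≡0 (~-unit⇒≢0 w≉0 hr)
      where
      lemma : ∀ w w⁻¹ → + 1 - + 0 ≡ - + 1 * (w * w⁻¹ - + 1) + w⁻¹ * (w - + 0)
      lemma = solve-∀
      w≉0 : w ≉ + 0
      w≉0 w≈0 = 1≉0 (by₂ (- + 1) w⁻¹ inv w≈0 (lemma w w⁻¹))
    ... | no r≢0 = ~-* hq (~-1/ {{ℚ.≢-nonZero r≢0}} hr inv)

    ~-sumTo : ∀ n {f g} → (∀ k → k ℕ.≤ n → f k ~ g k) → sumTo n f ~ sum n g
    ~-sumTo zero    h = h 0 z≤n
    ~-sumTo (suc n) h = ~-+ (~-sumTo n (λ k k≤n → h k (ℕ.m≤n⇒m≤1+n k≤n))) (h (suc n) ℕ.≤-refl)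

    numerator*den : ∀ q d n → q ℚ.* ℤ→ℚ d ≡ ℤ→ℚ n → ↥ q * d ≡ n * + ↧ₙ q
    numerator*den q d n eq = ℤ→ℚ-injective (begin
      ℤ→ℚ (↥ q * d)                       ≡⟨ ℤ→ℚ-* (↥ q) d ⟩
      ℤ→ℚ (↥ q) ℚ.* ℤ→ℚ d                 ≡⟨ cong (ℚ._* ℤ→ℚ d) (*-denominator q) ⟨
      q ℚ.* ℤ→ℚ (+ ↧ₙ q) ℚ.* ℤ→ℚ d        ≡⟨ swap q (ℤ→ℚ (+ ↧ₙ q)) (ℤ→ℚ d) ⟩
      q ℚ.* ℤ→ℚ d ℚ.* ℤ→ℚ (+ ↧ₙ q)        ≡⟨ cong (ℚ._* ℤ→ℚ (+ ↧ₙ q)) eq ⟩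
      ℤ→ℚ n ℚ.* ℤ→ℚ (+ ↧ₙ q)              ≡⟨ ℤ→ℚ-* n (+ ↧ₙ q) ⟨
      ℤ→ℚ (n * + ↧ₙ q)                    ∎)
      where
      open ≡-Reasoning
      swap : ∀ a b c → a ℚ.* b ℚ.* c ≡ a ℚ.* c ℚ.* b
      swap = solve 3 (λ a b c → a :* b :* c := a :* c :* b) refl

    -- The fraction witnessing q ~ z need not be in lowest terms, so its numerator is compared with
    -- the reduced one by cross-multiplication.
    ~⇒≡0mod : ∀ {q z} → q ~ z → z ≈ + 0 → ≡0mod p q
    ~⇒≡0mod {q} {z} (reduces d n hd eq h) z≈0 = ≈0⇒p∣ (*-cancelˡ d hd
      (by₃ (+ 1) (+ ↧ₙ q) (d * + ↧ₙ q) (≡⇒≈ (numerator*den q d n eq)) h z≈0 (lemma (↥ q) (+ ↧ₙ q) d n z)))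
      where
      lemma : ∀ a b d n z → d * a - d * + 0 ≡ + 1 * (a * d - n * b) + b * (n - z * d) + d * b * (z - + 0)
      lemma = solve-∀

    ~⇒≡mod : ∀ {q r z w} → q ~ z → r ~ w → z ≈ w → q ≡ r [modℚ p ]
    ~⇒≡mod hq hr h = ~⇒≡0mod (~-+ hq (~-neg hr)) (diff≈0 h)

    InD⇒~ : ∀ {q} → InD p q → ∃ λ z → q ~ z
    InD⇒~ {q} h = helper (inverse den≉0)
      where
      den≉0 : + ↧ₙ q ≉ + 0
      den≉0 d≈0 = h (≈0⇒p∣ {+ ↧ₙ q} d≈0)
      lemma : ∀ a b w → a - a * w * b ≡ - a * (b * w - + 1)
      lemma = solve-∀
      helper : (∃ λ w → + ↧ₙ q * w ≈ + 1) → ∃ λ z → q ~ z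
      helper (w , dw≈1) = ↥ q * w , reduces (+ ↧ₙ q) (↥ q) den≉0 (*-denominator q)
        (by₁ (- ↥ q) dw≈1 (lemma (↥ q) (+ ↧ₙ q) w))

    coprime⇒ : ∀ q → ↥ q ≈ + 0 → + ↧ₙ q ≉ + 0
    coprime⇒ (mkℚ n d-1 coprime) n≈0 d≈0 = ⊥-elim-irr (ℕ.<⇒≢ 1<p (sym (coprime (≈0⇒p∣ n≈0 , ≈0⇒p∣ {+ suc d-1} d≈0))))
      where
      1<p : 1 ℕ.< p
      1<p = ℕ.<-trans (s<s z<s) 3<p

    -- If p divided the reduced denominator, cross-multiplication would make it divide the reduced
    -- numerator too.
    ~⇒den≉0 : ∀ {q z} → q ~ z → + ↧ₙ q ≉ + 0
    ~⇒den≉0 {q} {z} (reduces d n hd eq h) b≈0 = coprime⇒ q (*-cancelˡ d hd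
      (by₂ (+ 1) n (≡⇒≈ (numerator*den q d n eq)) b≈0 (lemma (↥ q) (+ ↧ₙ q) d n))) b≈0
      where
      lemma : ∀ a b d n → d * a - d * + 0 ≡ + 1 * (a * d - n * b) + n * (b - + 0)
      lemma = solve-∀

    -- With q = a/b reduced, ab = (a/b)b² and b is a unit, so Euler's criterion for ab yields z^N
    -- (b^N)² ≈ z^N.
    ~-legendre : ∀ {q z} → q ~ z → legendre q p ~ z ^ N
    ~-legendre {q} {z} hq@(reduces d n hd eq h) = ~-resp-≈ (~-ℤ (legendreℤ (a * b) p))
      (≈-trans (euler (a * b)) (≈-trans (^-cong N ab≈) (≈-trans (≡⇒≈ (trans (^-distrib-* z (b * b) N)
        (cong (z ^ N *_) (^-distrib-* b b N))))
        (≈-trans (*-cong (≈-refl {z ^ N}) (fermat-unit (~⇒den≉0 hq))) (≡⇒≈ (*-identityʳ (z ^ N)))))))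
      where
      a b : ℤ
      a = ↥ q
      b = + ↧ₙ q
      lemma : ∀ a b d n z → d * (a * b) - d * (z * (b * b)) ≡ b * (a * d - n * b) + b * b * (n - z * d)
      lemma = solve-∀
      ab≈ : a * b ≈ z * (b * b)
      ab≈ = *-cancelˡ d hd (by₂ b (b * b) (≡⇒≈ (numerator*den q d n eq)) h (lemma a b d n z))

  -- The numbers S as quotients of factorials

  ℕ→ℚ-* : ∀ a b → ℕ→ℚ (a ℕ.* b) ≡ ℕ→ℚ a ℚ.* ℕ→ℚ b
  ℕ→ℚ-* a b = trans (cong ℤ→ℚ (pos-* a b)) (ℤ→ℚ-* (+ a) (+ b))

  ℕ→ℚ≢0 : ∀ d .{{_ : ℕ.NonZero d}} → ℕ→ℚ d ≢ 0ℚ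
  ℕ→ℚ≢0 d eq = ℕ.≢-nonZero⁻¹ d (+-injective (ℤ→ℚ-injective eq))

  ÷-*-cancel : ∀ x y → y ≢ 0ℚ → (x ÷ y) ℚ.* y ≡ x
  ÷-*-cancel x y y≢0 with y ℚ.≟ 0ℚ
  ... | yes y≡0 = contradiction y≡0 y≢0
  ... | no  y≢0 = trans (ℚ.*-assoc x _ y) (trans (cong (x ℚ.*_) (ℚ.*-inverseˡ y {{ℚ.≢-nonZero y≢0}})) (ℚ.*-identityʳ x))

  ℚ-*-cancelʳ : ∀ {x y} d → d ≢ 0ℚ → x ℚ.* d ≡ y ℚ.* d → x ≡ y
  ℚ-*-cancelʳ {x} {y} d d≢0 eq = trans (sym (undo x)) (trans (cong (ℚ._* (ℚ.1/ d)) eq) (undo y))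
    where
    instance _ = ℚ.≢-nonZero d≢0
    undo : ∀ z → z ℚ.* d ℚ.* (ℚ.1/ d) ≡ z
    undo z = trans (ℚ.*-assoc z d (ℚ.1/ d)) (trans (cong (z ℚ.*_) (ℚ.*-inverseʳ d)) (ℚ.*-identityʳ z))

  C-factorial : ∀ {n k} → k ℕ.≤ n → (n C k) ℕ.* (k ! ℕ.* (n ℕ.∸ k) !) ≡ n !
  C-factorial {n} {k} k≤n = trans (cong (ℕ._* (k ! ℕ.* (n ℕ.∸ k) !)) (nCk≡n!/k![n-k]! k≤n)) (m/n*n≡m (k![n∸k]!∣n! k≤n))
    where instance _ = k ℕ.!* (n ℕ.∸ k) !≢0

  C-factorial-+ : ∀ k l {n} → n ≡ k ℕ.+ l → (n C k) ℕ.* (k ! ℕ.* l !) ≡ n !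
  C-factorial-+ k l refl = subst (λ j → ((k ℕ.+ l) C k) ℕ.* (k ! ℕ.* j !) ≡ (k ℕ.+ l) !) (ℕ.m+n∸m≡n k l) (C-factorial (ℕ.m≤m+n k l))

  SNum SDen : ℕ → ℕ
  SNum n = (6 ℕ.* n) ! ℕ.* n !
  SDen n = 2 ℕ.* (3 ℕ.* n) ! ℕ.* ((2 ℕ.* n) ! ℕ.* ((2 ℕ.* n) ! ℕ.* (2 ℕ.* n ℕ.+ 1)))

  S-factorial : ∀ n → S n ℚ.* ℕ→ℚ (SDen n) ≡ ℕ→ℚ (SNum n)
  S-factorial n = begin
    S n ℚ.* ℕ→ℚ (SDen n) ≡⟨ cong (λ k → S n ℚ.* ℕ→ℚ k) den ⟩
    S n ℚ.* ℕ→ℚ (2 ℕ.* D ℕ.* w ℕ.* c) ≡⟨ cong (S n ℚ.*_) (ℕ→ℚ-* (2 ℕ.* D ℕ.* w) c) ⟩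
    S n ℚ.* (ℕ→ℚ (2 ℕ.* D ℕ.* w) ℚ.* ℕ→ℚ c) ≡⟨ ℚ.*-assoc (S n) _ _ ⟨
    S n ℚ.* ℕ→ℚ (2 ℕ.* D ℕ.* w) ℚ.* ℕ→ℚ c ≡⟨ cong (ℚ._* ℕ→ℚ c) quotient ⟩
    ℕ→ℚ (A ℕ.* B) ℚ.* ℕ→ℚ c ≡⟨ ℕ→ℚ-* (A ℕ.* B) c ⟨
    ℕ→ℚ (A ℕ.* B ℕ.* c) ≡⟨ cong ℕ→ℚ num ⟨
    ℕ→ℚ (SNum n) ∎
    where
    open ≡-Reasoning
    A = (6 ℕ.* n) C (3 ℕ.* n)
    B = (3 ℕ.* n) C n
    D = (2 ℕ.* n) C n
    w = 2 ℕ.* n ℕ.+ 1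
    -- Multiplying both A·B and 2·D·w by this factor turns all the binomials into factorials.
    c = (3 ℕ.* n) ! ℕ.* (n ! ℕ.* n ! ℕ.* (2 ℕ.* n) !)
    A! : A ℕ.* ((3 ℕ.* n) ! ℕ.* (3 ℕ.* n) !) ≡ (6 ℕ.* n) !
    A! = C-factorial-+ (3 ℕ.* n) (3 ℕ.* n) (lemma n)
      where
      lemma : ∀ n → 6 ℕ.* n ≡ 3 ℕ.* n ℕ.+ 3 ℕ.* n
      lemma = ℕ-Solver.solve-∀
    B! : B ℕ.* (n ! ℕ.* (2 ℕ.* n) !) ≡ (3 ℕ.* n) !
    B! = C-factorial-+ n (2 ℕ.* n) (lemma n)
      where
      lemma : ∀ n → 3 ℕ.* n ≡ n ℕ.+ 2 ℕ.* n
      lemma = ℕ-Solver.solve-∀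
    D! : D ℕ.* (n ! ℕ.* n !) ≡ (2 ℕ.* n) !
    D! = C-factorial-+ n n (lemma n)
      where
      lemma : ∀ n → 2 ℕ.* n ≡ n ℕ.+ n
      lemma = ℕ-Solver.solve-∀
    den : SDen n ≡ 2 ℕ.* D ℕ.* w ℕ.* c
    den = trans (cong (λ x → 2 ℕ.* (3 ℕ.* n) ! ℕ.* (x ℕ.* ((2 ℕ.* n) ! ℕ.* w))) (sym D!))
      (lemma ((3 ℕ.* n) !) D (n !) ((2 ℕ.* n) !) w)
      where
      lemma : ∀ x D y z w → 2 ℕ.* x ℕ.* (D ℕ.* (y ℕ.* y) ℕ.* (z ℕ.* w)) ≡ 2 ℕ.* D ℕ.* w ℕ.* (x ℕ.* (y ℕ.* y ℕ.* z))
      lemma = ℕ-Solver.solve-∀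
    num : SNum n ≡ A ℕ.* B ℕ.* c
    num = trans (cong (ℕ._* n !) (sym A!)) (trans (cong (λ x → A ℕ.* ((3 ℕ.* n) ! ℕ.* x) ℕ.* n !) (sym B!))
      (lemma A B ((3 ℕ.* n) !) (n !) ((2 ℕ.* n) !)))
      where
      lemma : ∀ A B x y z → A ℕ.* (x ℕ.* (B ℕ.* (y ℕ.* z))) ℕ.* y ≡ A ℕ.* B ℕ.* (x ℕ.* (y ℕ.* y ℕ.* z))
      lemma = ℕ-Solver.solve-∀
    instance
      D≢0 : ℕ.NonZero D
      D≢0 = ℕ.≢-nonZero λ D≡0 → ℕ.≢-nonZero⁻¹ ((2 ℕ.* n) !) {{(2 ℕ.* n) ℕ.!≢0}} (trans (sym D!) (cong (ℕ._* (n ! ℕ.* n !)) D≡0))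
      w≢0 : ℕ.NonZero w
      w≢0 = ℕ.≢-nonZero λ w≡0 → ℕ.1+n≢0 (trans (ℕ.+-comm 1 (2 ℕ.* n)) w≡0)
      2Dw≢0 : ℕ.NonZero (2 ℕ.* D ℕ.* w)
      2Dw≢0 = ℕ.m*n≢0 (2 ℕ.* D) w {{ℕ.m*n≢0 2 D}}
    ℚden : ℕ→ℚ (2 ℕ.* D ℕ.* w) ≡ ℕ→ℚ 2 ℚ.* ℕ→ℚ D ℚ.* ℕ→ℚ w
    ℚden = trans (ℕ→ℚ-* (2 ℕ.* D) w) (cong (ℚ._* ℕ→ℚ w) (ℕ→ℚ-* 2 D))
    quotient : S n ℚ.* ℕ→ℚ (2 ℕ.* D ℕ.* w) ≡ ℕ→ℚ (A ℕ.* B)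
    quotient = begin
      S n ℚ.* ℕ→ℚ (2 ℕ.* D ℕ.* w) ≡⟨ cong (S n ℚ.*_) ℚden ⟩
      S n ℚ.* (ℕ→ℚ 2 ℚ.* ℕ→ℚ D ℚ.* ℕ→ℚ w)
        ≡⟨ ÷-*-cancel (ℕ→ℚ A ℚ.* ℕ→ℚ B) (ℕ→ℚ 2 ℚ.* ℕ→ℚ D ℚ.* ℕ→ℚ w) (λ eq → ℕ→ℚ≢0 (2 ℕ.* D ℕ.* w) (trans ℚden eq)) ⟩
      ℕ→ℚ A ℚ.* ℕ→ℚ B ≡⟨ ℕ→ℚ-* A B ⟨
      ℕ→ℚ (A ℕ.* B) ∎

  SDen≢0 : ∀ n → ℕ.NonZero (SDen n)
  SDen≢0 n = ℕ.m*n≢0 (2 ℕ.* (3 ℕ.* n) !) _ {{ℕ.m*n≢0 2 _ {{_}} {{(3 ℕ.* n) ℕ.!≢0}}}}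
    {{ℕ.m*n≢0 _ _ {{(2 ℕ.* n) ℕ.!≢0}} {{ℕ.m*n≢0 _ _ {{(2 ℕ.* n) ℕ.!≢0}} {{ℕ.≢-nonZero λ w≡0 → ℕ.1+n≢0 (trans (ℕ.+-comm 1 (2 ℕ.* n)) w≡0)}}}}}}

  -- The factor c may be divisible by p: this is how powers of p are removed before a fraction is
  -- reduced modulo p.
  fraction-cancel : ∀ q c d n → .{{ℕ.NonZero c}} → q ℚ.* ℕ→ℚ (c ℕ.* d) ≡ ℕ→ℚ (c ℕ.* n) → q ℚ.* ℕ→ℚ d ≡ ℕ→ℚ n
  fraction-cancel q c d n eq = ℚ-*-cancelʳ (ℕ→ℚ c) (ℕ→ℚ≢0 c) (begin
    q ℚ.* ℕ→ℚ d ℚ.* ℕ→ℚ c ≡⟨ ℚ.*-assoc q (ℕ→ℚ d) (ℕ→ℚ c) ⟩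
    q ℚ.* (ℕ→ℚ d ℚ.* ℕ→ℚ c) ≡⟨ cong (q ℚ.*_) (trans (ℚ.*-comm (ℕ→ℚ d) (ℕ→ℚ c)) (sym (ℕ→ℚ-* c d))) ⟩
    q ℚ.* ℕ→ℚ (c ℕ.* d) ≡⟨ eq ⟩
    ℕ→ℚ (c ℕ.* n) ≡⟨ trans (ℕ→ℚ-* c n) (ℚ.*-comm (ℕ→ℚ c) (ℕ→ℚ n)) ⟩
    ℕ→ℚ n ℚ.* ℕ→ℚ c ∎)
    where open ≡-Reasoning

  S-ratio : ∀ n → S (suc n) ℚ.* ℕ→ℚ (suc n ℕ.* (2 ℕ.* n ℕ.+ 3)) ≡ S n ℚ.* ℕ→ℚ (6 ℕ.* (6 ℕ.* n ℕ.+ 5) ℕ.* (6 ℕ.* n ℕ.+ 1))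
  S-ratio n = ℚ-*-cancelʳ (ℕ→ℚ (Z ℕ.* SDen n)) (ℕ→ℚ≢0 (Z ℕ.* SDen n) {{ℕ.m*n≢0 Z (SDen n) {{Z≢0}} {{SDen≢0 n}}}}) (begin
    S (suc n) ℚ.* ℕ→ℚ r ℚ.* ℕ→ℚ (Z ℕ.* SDen n) ≡⟨ ℚ.*-assoc (S (suc n)) (ℕ→ℚ r) _ ⟩
    S (suc n) ℚ.* (ℕ→ℚ r ℚ.* ℕ→ℚ (Z ℕ.* SDen n)) ≡⟨ cong (S (suc n) ℚ.*_) (ℕ→ℚ-* r (Z ℕ.* SDen n)) ⟨
    S (suc n) ℚ.* ℕ→ℚ (r ℕ.* (Z ℕ.* SDen n)) ≡⟨ cong (λ k → S (suc n) ℚ.* ℕ→ℚ k) den ⟨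
    S (suc n) ℚ.* ℕ→ℚ (SDen (suc n)) ≡⟨ S-factorial (suc n) ⟩
    ℕ→ℚ (SNum (suc n)) ≡⟨ cong ℕ→ℚ num ⟩
    ℕ→ℚ (s ℕ.* Z ℕ.* SNum n) ≡⟨ ℕ→ℚ-* (s ℕ.* Z) (SNum n) ⟩
    ℕ→ℚ (s ℕ.* Z) ℚ.* ℕ→ℚ (SNum n) ≡⟨ cong₂ ℚ._*_ (ℕ→ℚ-* s Z) (sym (S-factorial n)) ⟩
    ℕ→ℚ s ℚ.* ℕ→ℚ Z ℚ.* (S n ℚ.* ℕ→ℚ (SDen n)) ≡⟨ swap (ℕ→ℚ s) (ℕ→ℚ Z) (S n) (ℕ→ℚ (SDen n)) ⟩
    S n ℚ.* ℕ→ℚ s ℚ.* (ℕ→ℚ Z ℚ.* ℕ→ℚ (SDen n)) ≡⟨ cong (S n ℚ.* ℕ→ℚ s ℚ.*_) (ℕ→ℚ-* Z (SDen n)) ⟨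
    S n ℚ.* ℕ→ℚ s ℚ.* ℕ→ℚ (Z ℕ.* SDen n) ∎)
    where
    open ≡-Reasoning
    r = suc n ℕ.* (2 ℕ.* n ℕ.+ 3)
    s = 6 ℕ.* (6 ℕ.* n ℕ.+ 5) ℕ.* (6 ℕ.* n ℕ.+ 1)
    -- The factor common to SNum (n+1)/SNum n and SDen (n+1)/SDen n; what remains of them is s and
    -- r.
    Z = (3 ℕ.+ 3 ℕ.* n) ℕ.* (2 ℕ.+ 3 ℕ.* n) ℕ.* (1 ℕ.+ 3 ℕ.* n) ℕ.* 4 ℕ.* (1 ℕ.+ n) ℕ.* (1 ℕ.+ 2 ℕ.* n)
    Z≢0 : ℕ.NonZero Z
    Z≢0 = _
    swap : ∀ a b c d → a ℚ.* b ℚ.* (c ℚ.* d) ≡ c ℚ.* a ℚ.* (b ℚ.* d)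
    swap = solve 4 (λ a b c d → a :* b :* (c :* d) := c :* a :* (b :* d)) refl
    den : SDen (suc n) ≡ r ℕ.* (Z ℕ.* SDen n)
    den = trans (cong₂ (λ u v → 2 ℕ.* u ! ℕ.* (v ! ℕ.* (v ! ℕ.* (v ℕ.+ 1)))) (ℕ.*-suc 3 n) (ℕ.*-suc 2 n))
      (lemma n ((3 ℕ.* n) !) ((2 ℕ.* n) !))
      where
      lemma : ∀ n x y →
        let v = (2 ℕ.+ 2 ℕ.* n) ℕ.* ((1 ℕ.+ 2 ℕ.* n) ℕ.* y) in
        2 ℕ.* ((3 ℕ.+ 3 ℕ.* n) ℕ.* ((2 ℕ.+ 3 ℕ.* n) ℕ.* ((1 ℕ.+ 3 ℕ.* n) ℕ.* x))) ℕ.* (v ℕ.* (v ℕ.* (2 ℕ.+ 2 ℕ.* n ℕ.+ 1)))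
        ≡ (1 ℕ.+ n) ℕ.* (2 ℕ.* n ℕ.+ 3) ℕ.* ((3 ℕ.+ 3 ℕ.* n) ℕ.* (2 ℕ.+ 3 ℕ.* n) ℕ.* (1 ℕ.+ 3 ℕ.* n) ℕ.* 4 ℕ.* (1 ℕ.+ n) ℕ.* (1 ℕ.+ 2 ℕ.* n)
          ℕ.* (2 ℕ.* x ℕ.* (y ℕ.* (y ℕ.* (2 ℕ.* n ℕ.+ 1)))))
      lemma = ℕ-Solver.solve-∀
    num : SNum (suc n) ≡ s ℕ.* Z ℕ.* SNum n
    num = trans (cong (λ u → u ! ℕ.* (suc n) !) (ℕ.*-suc 6 n)) (lemma n ((6 ℕ.* n) !) (n !))
      where
      lemma : ∀ n x y →
        (6 ℕ.+ 6 ℕ.* n) ℕ.* ((5 ℕ.+ 6 ℕ.* n) ℕ.* ((4 ℕ.+ 6 ℕ.* n) ℕ.* ((3 ℕ.+ 6 ℕ.* n) ℕ.* ((2 ℕ.+ 6 ℕ.* n) ℕ.* ((1 ℕ.+ 6 ℕ.* n) ℕ.* x))))) ℕ.* ((1 ℕ.+ n) ℕ.* y)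
        ≡ 6 ℕ.* (6 ℕ.* n ℕ.+ 5) ℕ.* (6 ℕ.* n ℕ.+ 1)
          ℕ.* ((3 ℕ.+ 3 ℕ.* n) ℕ.* (2 ℕ.+ 3 ℕ.* n) ℕ.* (1 ℕ.+ 3 ℕ.* n) ℕ.* 4 ℕ.* (1 ℕ.+ n) ℕ.* (1 ℕ.+ 2 ℕ.* n)) ℕ.* (x ℕ.* y)
      lemma = ℕ-Solver.solve-∀

  -- The product (a+1)...(a+k) = (a+k)!/a!. Modulo p it depends only on the residue of a, which
  -- gives access to the part of a factorial beyond p.
  rise : ℕ → ℕ → ℕ
  rise a zero    = 1
  rise a (suc k) = rise a k ℕ.* (a ℕ.+ suc k)

  rise-! : ∀ a k → (a ℕ.+ k) ! ≡ a ! ℕ.* rise a k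
  rise-! a zero    = trans (cong _! (ℕ.+-identityʳ a)) (sym (ℕ.*-identityʳ (a !)))
  rise-! a (suc k) rewrite ℕ.+-suc a k = trans (cong (suc (a ℕ.+ k) ℕ.*_) (rise-! a k))
    (lemma (a !) (rise a k) (suc (a ℕ.+ k)))
    where
    lemma : ∀ x y z → z ℕ.* (x ℕ.* y) ≡ x ℕ.* (y ℕ.* z)
    lemma = ℕ-Solver.solve-∀

  rise-0 : ∀ k → rise 0 k ≡ k !
  rise-0 k = sym (trans (rise-! 0 k) (ℕ.+-identityʳ (rise 0 k)))

  -- S modulo p below, at and above the middle index

  module SMod (N : ℕ) (p-prime : Prime (suc (N ℕ.+ N))) (3<p : 3 ℕ.< suc (N ℕ.+ N)) where
    open OddPrime N p-prime 3<p
    open Reduction N p-prime 3<p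

    rise-cong : ∀ {a b} k → + a ≈ + b → + rise a k ≈ + rise b k
    rise-cong zero h = ≈-refl
    rise-cong {a} {b} (suc k) h = ≈-trans (≡⇒≈ (pos-* (rise a k) (a ℕ.+ suc k)))
      (≈-trans (*-cong (rise-cong k h) (+-cong h (≈-refl {+ suc k}))) (≡⇒≈ (sym (pos-* (rise b k) (b ℕ.+ suc k)))))

    rise≈! : ∀ {a} k → + a ≈ + 0 → + rise a k ≈ + (k !)
    rise≈! k h = ≈-trans (rise-cong k h) (≡⇒≈ (cong +_ (rise-0 k)))

    !≉0 : ∀ k → k ℕ.< p → + (k !) ≉ + 0
    !≉0 zero    _   = 1≉0
    !≉0 (suc k) k<p h = *-≉0 (0<n<p⇒≉0 {suc k} z<s k<p) (!≉0 k (ℕ.<-trans (ℕ.n<1+n k) k<p))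
      (≈-trans (≡⇒≈ (sym (pos-* (suc k) (k !)))) h)

    -- Numerator and denominator of S N, written with factorials, both contain p exactly twice.
    S-middle : ∀ r → N ≡ 2 ℕ.+ r → ∀ z → + 4 * z ≈ - + 1 → S N ~ z
    S-middle r N≡2+r z 4z≈-1 = reduces (+ (R₁ ℕ.* (F ℕ.* F))) (+ (F₁ ℕ.* (R₂ ℕ.* N !)))
      den≉0
      (fraction-cancel (S N) (2 ℕ.* (p ℕ.* (p ℕ.* F))) (R₁ ℕ.* (F ℕ.* F)) (F₁ ℕ.* (R₂ ℕ.* N !)) {{c≢0}}
        (trans (cong (λ k → S N ℚ.* ℕ→ℚ k) (sym den)) (trans (S-factorial N) (cong ℕ→ℚ num))))
      num≈
      where
      -- (3N)! is cut at p and (6N)! at p and 2p. `R₁` and `R₂` are the last blocks, congruent to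
      -- `G` and `K`; `F₁` is the block from p+1 to 2p-1, congruent to `F` = (p-1)!.
      F F₁ R₁ R₂ G K : ℕ
      F  = (N ℕ.+ N) !
      F₁ = rise p (N ℕ.+ N)
      R₁ = rise p (suc r)
      R₂ = rise (p ℕ.+ p) (2 ℕ.+ (r ℕ.+ r))
      G  = (suc r) !
      K  = (2 ℕ.+ (r ℕ.+ r)) !
      instance
        _ = (N ℕ.+ N) ℕ.!≢0
      c≢0 : ℕ.NonZero (2 ℕ.* (p ℕ.* (p ℕ.* F)))
      c≢0 = ℕ.m*n≢0 2 _ {{_}} {{ℕ.m*n≢0 p _ {{_}} {{ℕ.m*n≢0 p F}}}}
      3N : 3 ℕ.* N ≡ p ℕ.+ suc r
      3N = subst (λ N → 3 ℕ.* N ≡ suc (N ℕ.+ N) ℕ.+ suc r) (sym N≡2+r) (lemma r)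
        where
        lemma : ∀ r → 3 ℕ.* (2 ℕ.+ r) ≡ 1 ℕ.+ ((2 ℕ.+ r) ℕ.+ (2 ℕ.+ r)) ℕ.+ (1 ℕ.+ r)
        lemma = ℕ-Solver.solve-∀
      6N : 6 ℕ.* N ≡ p ℕ.+ p ℕ.+ (2 ℕ.+ (r ℕ.+ r))
      6N = subst (λ N → 6 ℕ.* N ≡ suc (N ℕ.+ N) ℕ.+ suc (N ℕ.+ N) ℕ.+ (2 ℕ.+ (r ℕ.+ r))) (sym N≡2+r) (lemma r)
        where
        lemma : ∀ r → 6 ℕ.* (2 ℕ.+ r) ≡ 1 ℕ.+ ((2 ℕ.+ r) ℕ.+ (2 ℕ.+ r)) ℕ.+ (1 ℕ.+ ((2 ℕ.+ r) ℕ.+ (2 ℕ.+ r))) ℕ.+ (2 ℕ.+ (r ℕ.+ r))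
        lemma = ℕ-Solver.solve-∀
      2N : 2 ℕ.* N ≡ N ℕ.+ N
      2N = cong (N ℕ.+_) (ℕ.+-identityʳ N)
      3N! : (3 ℕ.* N) ! ≡ p ℕ.* F ℕ.* R₁
      3N! = trans (cong _! 3N) (rise-! p (suc r))
      6N! : (6 ℕ.* N) ! ≡ p ℕ.* F ℕ.* (F₁ ℕ.* (p ℕ.+ p)) ℕ.* R₂
      6N! = trans (cong _! 6N) (trans (rise-! (p ℕ.+ p) (2 ℕ.+ (r ℕ.+ r))) (cong (ℕ._* R₂) (rise-! p p)))
      den : SDen N ≡ 2 ℕ.* (p ℕ.* (p ℕ.* F)) ℕ.* (R₁ ℕ.* (F ℕ.* F))
      den = trans (cong₂ (λ u v → 2 ℕ.* u ℕ.* (v ! ℕ.* (v ! ℕ.* (v ℕ.+ 1)))) 3N! 2N)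
        (trans (cong (λ u → 2 ℕ.* (p ℕ.* F ℕ.* R₁) ℕ.* (F ℕ.* (F ℕ.* u))) (ℕ.+-comm (N ℕ.+ N) 1)) (lemma p F R₁))
        where
        lemma : ∀ p F R → 2 ℕ.* (p ℕ.* F ℕ.* R) ℕ.* (F ℕ.* (F ℕ.* p)) ≡ 2 ℕ.* (p ℕ.* (p ℕ.* F)) ℕ.* (R ℕ.* (F ℕ.* F))
        lemma = ℕ-Solver.solve-∀
      num : SNum N ≡ 2 ℕ.* (p ℕ.* (p ℕ.* F)) ℕ.* (F₁ ℕ.* (R₂ ℕ.* N !))
      num = trans (cong (ℕ._* N !) 6N!) (lemma p F F₁ R₂ (N !))
        where
        lemma : ∀ p F F₁ R n → p ℕ.* F ℕ.* (F₁ ℕ.* (p ℕ.+ p)) ℕ.* R ℕ.* n ≡ 2 ℕ.* (p ℕ.* (p ℕ.* F)) ℕ.* (F₁ ℕ.* (R ℕ.* n))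
        lemma = ℕ-Solver.solve-∀
      R₁≈ : + R₁ ≈ + G
      R₁≈ = rise≈! (suc r) p≈0
      R₂≈ : + R₂ ≈ + K
      R₂≈ = rise≈! (2 ℕ.+ (r ℕ.+ r)) (+-cong p≈0 p≈0)
      F₁≈ : + F₁ ≈ + F
      F₁≈ = rise≈! (N ℕ.+ N) p≈0
      2+r<p : suc r ℕ.< p
      2+r<p = s≤s (ℕ.≤-trans (ℕ.≤-trans (ℕ.n≤1+n (suc r)) (ℕ.≤-reflexive (sym N≡2+r))) (ℕ.m≤m+n N N))
      cast₃ : ∀ x y z → + (x ℕ.* (y ℕ.* z)) ≡ + x * (+ y * + z)
      cast₃ x y z = trans (pos-* x (y ℕ.* z)) (cong (+ x *_) (pos-* y z))
      F≡ : + F ≡ (+ 4 + (+ r + + r)) * ((+ 3 + (+ r + + r)) * + K)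
      F≡ = trans (cong (λ n → + (n !)) (trans (cong₂ ℕ._+_ N≡2+r N≡2+r) (lemma r)))
        (cast₃ (4 ℕ.+ (r ℕ.+ r)) (3 ℕ.+ (r ℕ.+ r)) K)
        where
        lemma : ∀ r → 2 ℕ.+ r ℕ.+ (2 ℕ.+ r) ≡ 4 ℕ.+ (r ℕ.+ r)
        lemma = ℕ-Solver.solve-∀
      N!≡ : + (N !) ≡ (+ 2 + + r) * + G
      N!≡ = trans (cong (λ n → + (n !)) N≡2+r) (pos-* (2 ℕ.+ r) G)
      p≡ : + 5 + + 2 * + r ≈ + 0
      p≡ = ≈-trans (≡⇒≈ (lemma (+ r))) (≈-trans (≡⇒≈ (cong (λ n → + suc (n ℕ.+ n)) (sym N≡2+r))) p≈0)
        where
        lemma : ∀ r → + 5 + + 2 * r ≡ + 1 + (+ 2 + r + (+ 2 + r))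
        lemma = solve-∀
      num≈′ : + (F₁ ℕ.* (R₂ ℕ.* N !)) ≈ + F * (+ K * ((+ 2 + + r) * + G))
      num≈′ = ≈-trans (≡⇒≈ (cast₃ F₁ R₂ (N !))) (*-cong F₁≈ (*-cong R₂≈ (≡⇒≈ N!≡)))
      den≈′ : + (R₁ ℕ.* (F ℕ.* F)) ≈ + G * (+ F * ((+ 4 + (+ r + + r)) * ((+ 3 + (+ r + + r)) * + K)))
      den≈′ = ≈-trans (≡⇒≈ (cast₃ R₁ F F)) (*-cong R₁≈ (*-cong (≈-refl {+ F}) (≡⇒≈ F≡)))
      den≉0 : + (R₁ ℕ.* (F ℕ.* F)) ≉ + 0
      den≉0 h = *-≉0 (!≉0 (suc r) 2+r<p) (*-≉0 F≉0 F≉0)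
        (≈-trans (*-cong (≈-sym R₁≈) (≈-refl {+ F * + F})) (≈-trans (≡⇒≈ (sym (cast₃ R₁ F F))) h))
        where
        F≉0 : + F ≉ + 0
        F≉0 = !≉0 (N ℕ.+ N) (ℕ.n<1+n (N ℕ.+ N))
      -- After cancellation S N is N!K/(GF) modulo p, where N! = N·G and F = 2N(2N-1)K. This is
      -- 1/(2(2N-1)) = 1/(2(p-2)), hence -1/4.
      num≈ : + (F₁ ℕ.* (R₂ ℕ.* N !)) ≈ z * + (R₁ ℕ.* (F ℕ.* F))
      num≈ = *-cancelˡ (+ 4) 4≉0 (by₄ (+ 4) (+ 1) (- + (R₁ ℕ.* (F ℕ.* F))) (+ F * + K * + G * (+ 2 * (+ 2 + + r)))
        num≈′ den≈′ 4z≈-1 p≡ (lemma (+ (F₁ ℕ.* (R₂ ℕ.* N !))) (+ (R₁ ℕ.* (F ℕ.* F))) z (+ F) (+ K) (+ G) (+ r)))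
        where
        lemma : ∀ n d z f k g r → + 4 * n - + 4 * (z * d)
          ≡ + 4 * (n - f * (k * ((+ 2 + r) * g)))
          + + 1 * (d - g * (f * ((+ 4 + (r + r)) * ((+ 3 + (r + r)) * k))))
          + - d * (+ 4 * z - - + 1)
          + f * k * g * (+ 2 * (+ 2 + r)) * (+ 5 + + 2 * r - + 0)
        lemma = solve-∀

    cast-ratioDen : ∀ k → + (suc k ℕ.* (2 ℕ.* k ℕ.+ 3)) ≡ (+ k + + 1) * (+ 2 * + k + + 3)
    cast-ratioDen k = trans (pos-* (suc k) (2 ℕ.* k ℕ.+ 3)) (trans (cong (λ z → + suc k * (z + + 3)) (pos-* 2 k)) (lemma (+ k)))
      where
      lemma : ∀ k → (+ 1 + k) * (+ 2 * k + + 3) ≡ (k + + 1) * (+ 2 * k + + 3)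
      lemma = solve-∀

    cast-ratioNum : ∀ k → + (6 ℕ.* (6 ℕ.* k ℕ.+ 5) ℕ.* (6 ℕ.* k ℕ.+ 1)) ≡ + 6 * (+ 6 * + k + + 5) * (+ 6 * + k + + 1)
    cast-ratioNum k = trans (pos-* (6 ℕ.* (6 ℕ.* k ℕ.+ 5)) (6 ℕ.* k ℕ.+ 1))
      (cong₂ _*_ (trans (pos-* 6 (6 ℕ.* k ℕ.+ 5)) (cong (λ z → + 6 * (z + + 5)) (pos-* 6 k))) (cong (_+ + 1) (pos-* 6 k)))

    -- The recurrence can be divided modulo p when (k+1)(2k+3) is a unit; for k < p-1 this excludes
    -- exactly k = N-1.
    S-step : ∀ k {z w} → (+ k + + 1) * (+ 2 * + k + + 3) ≉ + 0 → S k ~ z →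
      w * ((+ k + + 1) * (+ 2 * + k + + 3)) ≈ z * (+ 6 * (+ 6 * + k + + 5) * (+ 6 * + k + + 1)) → S (suc k) ~ w
    S-step k {z} {w} unit h eq = ~-cancel (+ (suc k ℕ.* (2 ℕ.* k ℕ.+ 3)))
      (λ h′ → unit (≈-trans (≡⇒≈ (sym (cast-ratioDen k))) h′))
      (S-ratio k) (~-* h (~-ℤ (+ (6 ℕ.* (6 ℕ.* k ℕ.+ 5) ℕ.* (6 ℕ.* k ℕ.+ 1)))))
      (≈-trans (≡⇒≈ (cong (z *_) (cast-ratioNum k))) (≈-trans (≈-sym eq) (≡⇒≈ (cong (w *_) (sym (cast-ratioDen k))))))

    module _ (m : ℕ) (κ : ℤ) (κ-inverse : + 2 * (+ 2 * + m + + 1) * κ ≈ + 1)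
             (m-root : (+ 6 * + m + + 1) * (+ 6 * + m + + 5) ≈ + 0) where

      -- Induction along the recurrence. The factor κ is fixed by S 0 = 1/2 and `sinCoef m 0` =
      -- 2m+1; -432 is -4·108, as y stands for -4sin²z with sin²z = 108x.
      S-lower : ∀ k → k ℕ.< N → S k ~ κ * ((- + 432) ^ k * sinCoef m k)
      S-lower zero _ = ~-cancel {w = κ * (+ 1 * sinCoef m 0)} (+ 2) 2≉0 refl (~-ℤ (+ 1)) (≈-sym
        (by₃ (+ 1) (κ * + 2) (+ 2 * κ * (+ 2 * + m + + 1)) κ-inverse
          (≡⇒≈ (sinCoef-even m 0)) (≡⇒≈ (evenCoef-0 m)) (lemma κ (+ m) (sinCoef m 0) (evenCoef m 0))))
        where
        lemma : ∀ κ m q e → κ * (+ 1 * q) * + 2 - + 1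
              ≡ + 1 * (+ 2 * (+ 2 * m + + 1) * κ - + 1) + κ * + 2 * ((+ 2 * + 0 + + 1) * q - (+ 2 * m + + 1) * e)
              + + 2 * κ * (+ 2 * m + + 1) * (e - + 1)
        lemma = solve-∀
      S-lower (suc k) k<N = S-step k (*-≉0 (λ h → 0<n<p⇒≉0 {suc k} z<s (ℕ.<-trans k<N (s≤s (ℕ.m≤m+n N N))) (≈-trans (≡⇒≈ (lemma₁ (+ k))) h))
          (λ h → odd≉0 k<N (≈-trans (≡⇒≈ (lemma₂ (+ k))) h)))
        (S-lower k (ℕ.<-trans (ℕ.n<1+n k) k<N))
        (by₂ (- + 216 * κ * c) (- + 6 * κ * c * sinCoef m k) (≡⇒≈ (sinCoef-ratio m k)) m-root
          (lemma κ c (+ m) (+ k) (sinCoef m k) (sinCoef m (suc k))))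
        where
        c = (- + 432) ^ k
        lemma₁ : ∀ k → + 1 + k ≡ k + + 1
        lemma₁ = solve-∀
        lemma₂ : ∀ k → + 2 * (+ 1 + k) + + 1 ≡ + 2 * k + + 3
        lemma₂ = solve-∀
        lemma : ∀ κ c m k q q′ → κ * (- + 432 * c * q′) * ((k + + 1) * (+ 2 * k + + 3))
              - κ * (c * q) * (+ 6 * (+ 6 * k + + 5) * (+ 6 * k + + 1))
              ≡ - + 216 * κ * c * (+ 2 * (k + + 1) * (+ 2 * k + + 3) * q′ - (m - k) * (m + k + + 1) * q)
              + - + 6 * κ * c * q * ((+ 6 * m + + 1) * (+ 6 * m + + 5) - + 0)
        lemma = solve-∀

    module _ (M : ℕ) (σ : ℤ) (middle : S N ~ + 2 * σ) (M-root : + 9 * + M * + M ≈ + 1) where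

      -- The same induction from the middle. As N ≡ -1/2, the ratio at N+j is
      -- 24(9j²-1)/((j+1)(2j+1)), which `M-root` matches with `cosCoef-ratio`. The start is 2σ
      -- because `cosCoef M 0` = 2.
      S-upper : ∀ j → j ℕ.≤ N → S (N ℕ.+ j) ~ σ * ((- + 432) ^ j * cosCoef M j)
      S-upper zero _ = subst (λ n → S n ~ σ * (+ 1 * + 2)) (sym (ℕ.+-identityʳ N)) (~-resp-≈ middle (≡⇒≈ (lemma σ)))
        where
        lemma : ∀ σ → + 2 * σ ≡ σ * (+ 1 * + 2)
        lemma = solve-∀
      S-upper (suc j) j<N = subst (λ n → S n ~ σ * ((- + 432) ^ suc j * cosCoef M (suc j))) (sym (ℕ.+-suc N j))
        (S-step (N ℕ.+ j) unit (S-upper j (ℕ.<⇒≤ j<N)) (*-cancelˡ (+ 2) 2≉0 step))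
        where
        c = (- + 432) ^ j
        lemma₁ : ∀ n j → (+ 1 + j) * (+ 2 * j + + 1) - + 0
          ≡ + 1 * ((n + j + + 1) * (+ 2 * (n + j) + + 3) - + 0)
          + - (n + + 2 * j + + 2) * (+ 1 + (n + n) - + 0)
        lemma₁ = solve-∀
        unit : (+ (N ℕ.+ j) + + 1) * (+ 2 * + (N ℕ.+ j) + + 3) ≉ + 0
        unit h = *-≉0 (0<n<p⇒≉0 {suc j} z<s (s≤s (ℕ.≤-trans j<N (ℕ.m≤m+n N N)))) (odd≉0 j<N)
          (by₂ (+ 1) (- (+ N + + 2 * + j + + 2)) h p≈0 (lemma₁ (+ N) (+ j)))
        step : + 2 * (σ * (- + 432 * c * cosCoef M (suc j)) * ((+ N + + j + + 1) * (+ 2 * (+ N + + j) + + 3)))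
             ≈ + 2 * (σ * (c * cosCoef M j) * (+ 6 * (+ 6 * (+ N + + j) + + 5) * (+ 6 * (+ N + + j) + + 1)))
        step = by₃ (- + 432 * σ * c) (- + 48 * σ * c * cosCoef M j)
          (+ 2 * σ * c * (- + 432 * cosCoef M (suc j) * (+ N + + 2 * + j + + 2)
             - cosCoef M j * (+ 108 * + N + + 216 * + j + + 54)))
          (≡⇒≈ (cosCoef-ratio M j)) M-root p≈0
          (lemma σ c (+ M) (+ j) (+ N) (cosCoef M j) (cosCoef M (suc j)))
          where
          lemma : ∀ σ c m j n v v′ → + 2 * (σ * (- + 432 * c * v′) * ((n + j + + 1) * (+ 2 * (n + j) + + 3)))
            - + 2 * (σ * (c * v) * (+ 6 * (+ 6 * (n + j) + + 5) * (+ 6 * (n + j) + + 1)))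
            ≡ - + 432 * σ * c * (+ 2 * (j + + 1) * (+ 2 * j + + 1) * v′ - (m - j) * (m + j) * v)
            + - + 48 * σ * c * v * (+ 9 * m * m - + 1)
            + + 2 * σ * c * (- + 432 * v′ * (n + + 2 * j + + 2) - v * (+ 108 * n + + 216 * j + + 54)) * (+ 1 + (n + n) - + 0)
          lemma = solve-∀

  -- Rescaling and splitting sums

  scaled-eval : ∀ n κ c f x → sum n (λ k → κ * (c ^ k * f k) * x ^ k) ≡ κ * eval n f (c * x)
  scaled-eval n κ c f x = trans
    (sum-cong n (λ k → trans (lemma κ (c ^ k) (f k) (x ^ k)) (cong (λ z → κ * (f k * z)) (sym (^-distrib-* c x k)))))
    (sum-* n κ (λ k → f k * (c * x) ^ k))
    where
    lemma : ∀ κ c f x → κ * (c * f) * x ≡ κ * (f * (c * x))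
    lemma = solve-∀

  sumTo-split : ∀ n k f → sumTo (n ℕ.+ suc k) f ≡ sumTo n f ℚ.+ sumTo k (λ j → f (suc n ℕ.+ j))
  sumTo-split n zero f rewrite ℕ.+-comm n 1 | ℕ.+-identityʳ n = refl
  sumTo-split n (suc k) f rewrite ℕ.+-suc n (suc k) =
    trans (cong (ℚ._+ f (suc (n ℕ.+ suc k))) (sumTo-split n k f))
      (ℚ.+-assoc (sumTo n f) (sumTo k (λ j → f (suc n ℕ.+ j))) _)

  sumTo-half : ∀ {N n} → N ≡ suc n → ∀ f → sumTo (N ℕ.+ N) f ≡ sumTo n f ℚ.+ sumTo N (λ j → f (N ℕ.+ j))
  sumTo-half {n = n} refl f = trans (cong (λ k → sumTo k f) (sym (ℕ.+-suc n (suc n)))) (sumTo-split n (suc n) f)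

  -- Angle relations for p ≡ 1 and p ≡ 5 modulo 6

  -- The index is 3m+1 because 2(3m+1)+1 = 3(2m+1).
  sine-triple : ∀ y m → sine y (suc (m ℕ.+ (m ℕ.+ m))) ≡ (+ 3 + y) * sine (triple y) m
  sine-triple y m = trans (cong₂ (λ b c → b + y * (c + b) + + 2 * (c + b)) (even-triple y m) (odd-triple y m))
    (lemma y (even (triple y) m) (odd (triple y) m))
    where
    lemma : ∀ y β γ →
      let b = β - y * (+ 3 + y) * γ
          c = (+ 1 + y) * (+ 3 + y) * γ
      in b + y * (c + b) + + 2 * (c + b) ≡ (+ 3 + y) * (β + + 2 * γ)
    lemma = solve-∀

  even-triple-suc : ∀ y m → even y (suc (m ℕ.+ (m ℕ.+ m))) ≡ (+ 1 + y) * even (triple y) m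
  even-triple-suc y m = trans (cong₂ (λ b c → b + y * (c + b)) (even-triple y m) (odd-triple y m))
    (lemma y (even (triple y) m) (odd (triple y) m))
    where
    lemma : ∀ y β γ →
      let b = β - y * (+ 3 + y) * γ
          c = (+ 1 + y) * (+ 3 + y) * γ
      in b + y * (c + b) ≡ (+ 1 + y) * β
    lemma = solve-∀

  cosine-triple : ∀ y m → cosine y (m ℕ.+ (m ℕ.+ m)) ≡ cosine (triple y) m
  cosine-triple y m = trans (cong₂ (λ b c → + 2 * b - y * c) (even-triple y m) (odd-triple y m))
    (lemma y (even (triple y) m) (odd (triple y) m))
    where
    lemma : ∀ y β γ →
      let b = β - y * (+ 3 + y) * γ
          c = (+ 1 + y) * (+ 3 + y) * γ
      in + 2 * b - y * c ≡ + 2 * β - y * (+ 3 + y) * (+ 3 + y) * γ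
    lemma = solve-∀

  odd-double′ : ∀ y n → odd y (suc (n ℕ.+ n)) ≡ even y n * sine y n
  odd-double′ y n = trans (odd-double y n) (lemma (even y n) (odd y n))
    where
    lemma : ∀ b c → b * b + + 2 * b * c ≡ b * (b + + 2 * c)
    lemma = solve-∀

  cosine-double : ∀ y n → cosine y (suc (n ℕ.+ n)) ≡ (+ 4 + y) * even y n * even y n - + 2
  cosine-double y n = lin₃ (+ 2) (- y) (- + 2) (even-double y n) (odd-double y n) (even²-odd² y n)
    (lemma y (even y n) (odd y n) (even y (suc (n ℕ.+ n))) (odd y (suc (n ℕ.+ n))))
    where
    lemma : ∀ y b c b₂ c₂ → + 2 * b₂ - y * c₂ - ((+ 4 + y) * b * b - + 2)
      ≡ + 2 * (b₂ - ((+ 1 + y) * b * b + + 2 * y * b * c + y * c * c))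
      + - y * (c₂ - (b * b + + 2 * b * c))
      + - + 2 * (b * b - y * b * c - y * c * c - + 1)
    lemma = solve-∀

  -- For p = 2N + 1 and m = ⌊p/6⌋: ε = ±1 is p modulo 6, and suc M = (p - ε)/3.
  -- The four evaluation fields compare the angles 3(2m+1)w = (p + 2ε)w and 6(M+1)w = 2(p - ε)w with pw.
  record Shape (N m : ℕ) : Set where
    field
      -- `d₁` and `d₂` are the distances from m to N-1 and from suc M to N. `M` is one below the
      -- index in use, which is thereby visibly positive.
      M d₁ d₂ : ℕ
      ε       : ℤ
      ε²      : ε * ε ≡ + 1
      m-value : + 3 * (+ 2 * + m + + 1) ≡ + suc (N ℕ.+ N) + + 2 * ε
      M-value : + 3 * + suc M ≡ + suc (N ℕ.+ N) - ε
      m<N     : N ≡ suc (m ℕ.+ d₁)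
      M<N     : N ≡ suc M ℕ.+ d₂
      sine-m   : ∀ y → + 2 * sine y (suc (m ℕ.+ (m ℕ.+ m))) ≡ (+ 2 + y) * sine y N + ε * (+ 4 + y) * even y N
      even-m   : ∀ y → + 2 * even y (suc (m ℕ.+ (m ℕ.+ m))) ≡ (+ 2 + y) * even y N + ε * y * sine y N
      cosine-M : ∀ y → + 2 * cosine y (suc M ℕ.+ (suc M ℕ.+ suc M))
               ≡ (+ 2 + y) * cosine y (suc (N ℕ.+ N)) - ε * y * (+ 4 + y) * odd y (suc (N ℕ.+ N))
      odd-M    : ∀ y → + 2 * odd y (suc M ℕ.+ (suc M ℕ.+ suc M))
               ≡ (+ 2 + y) * odd y (suc (N ℕ.+ N)) - ε * cosine y (suc (N ℕ.+ N))
      sine-[-3] : sine (- + 3) N ≡ ε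

  -- This and the seven formulas that follow are addition formulas for a shift of the angle by 2w,
  -- with 2cos 2w = 2+y. The isolated factor `+ 1` or `- + 1` is the ε of the case in which each is
  -- used.
  sine-next : ∀ y n → + 2 * sine y (suc n) ≡ (+ 2 + y) * sine y n + + 1 * (+ 4 + y) * even y n
  sine-next y n = lemma y (even y n) (odd y n)
    where
    lemma : ∀ y b c → + 2 * (b + y * (c + b) + + 2 * (c + b)) ≡ (+ 2 + y) * (b + + 2 * c) + + 1 * (+ 4 + y) * b
    lemma = solve-∀

  even-next : ∀ y n → + 2 * even y (suc n) ≡ (+ 2 + y) * even y n + + 1 * y * sine y n
  even-next y n = lemma y (even y n) (odd y n)
    where
    lemma : ∀ y b c → + 2 * (b + y * (c + b)) ≡ (+ 2 + y) * b + + 1 * y * (b + + 2 * c)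
    lemma = solve-∀

  cosine-next : ∀ y n → + 2 * cosine y (suc n) ≡ (+ 2 + y) * cosine y n - - + 1 * y * (+ 4 + y) * odd y n
  cosine-next y n = lemma y (even y n) (odd y n)
    where
    lemma : ∀ y b c → + 2 * (+ 2 * (b + y * (c + b)) - y * (c + b)) ≡ (+ 2 + y) * (+ 2 * b - y * c) - - + 1 * y * (+ 4 + y) * c
    lemma = solve-∀

  odd-next : ∀ y n → + 2 * odd y (suc n) ≡ (+ 2 + y) * odd y n - - + 1 * cosine y n
  odd-next y n = lemma y (even y n) (odd y n)
    where
    lemma : ∀ y b c → + 2 * (c + b) ≡ (+ 2 + y) * c - - + 1 * (+ 2 * b - y * c)
    lemma = solve-∀

  sine-previous : ∀ y n → + 2 * sine y n ≡ (+ 2 + y) * sine y (suc n) + - + 1 * (+ 4 + y) * even y (suc n)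
  sine-previous y n = lemma y (even y n) (odd y n)
    where
    lemma : ∀ y b c → + 2 * (b + + 2 * c) ≡ (+ 2 + y) * (b + y * (c + b) + + 2 * (c + b)) + - + 1 * (+ 4 + y) * (b + y * (c + b))
    lemma = solve-∀

  even-previous : ∀ y n → + 2 * even y n ≡ (+ 2 + y) * even y (suc n) + - + 1 * y * sine y (suc n)
  even-previous y n = lemma y (even y n) (odd y n)
    where
    lemma : ∀ y b c → + 2 * b ≡ (+ 2 + y) * (b + y * (c + b)) + - + 1 * y * (b + y * (c + b) + + 2 * (c + b))
    lemma = solve-∀

  cosine-previous : ∀ y n → + 2 * cosine y n ≡ (+ 2 + y) * cosine y (suc n) - + 1 * y * (+ 4 + y) * odd y (suc n)
  cosine-previous y n = lemma y (even y n) (odd y n)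
    where
    lemma : ∀ y b c → + 2 * (+ 2 * b - y * c) ≡ (+ 2 + y) * (+ 2 * (b + y * (c + b)) - y * (c + b)) - + 1 * y * (+ 4 + y) * (c + b)
    lemma = solve-∀

  odd-previous : ∀ y n → + 2 * odd y n ≡ (+ 2 + y) * odd y (suc n) - + 1 * cosine y (suc n)
  odd-previous y n = lemma y (even y n) (odd y n)
    where
    lemma : ∀ y b c → + 2 * c ≡ (+ 2 + y) * (c + b) - + 1 * (+ 2 * (b + y * (c + b)) - y * (c + b))
    lemma = solve-∀

  -- Here p = 6(m+1)+1; the argument is shifted because the quotient 0 would give p = 1.
  shape₁ : ∀ m → let N = suc m ℕ.+ (suc m ℕ.+ suc m) in Shape N (suc m)
  shape₁ m = record
    { M = m ℕ.+ suc m ; d₁ = m ℕ.+ suc m ; d₂ = suc m ; ε = + 1 ; ε² = refl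
    ; m-value = m-value (+ m)
    ; M-value = M-value (+ m)
    ; m<N = cong suc (ℕ.+-suc m (m ℕ.+ suc m))
    ; M<N = sym (ℕ.+-assoc (suc m) (suc m) (suc m))
    ; sine-m = λ y → sine-next y N
    ; even-m = λ y → even-next y N
    ; cosine-M = λ y → trans (cong (λ n → + 2 * cosine y n) 3M) (cosine-previous y (N ℕ.+ N))
    ; odd-M = λ y → trans (cong (λ n → + 2 * odd y n) 3M) (odd-previous y (N ℕ.+ N))
    ; sine-[-3] = cong₂ (λ b c → b + + 2 * c) (even-[-3] (suc m)) (odd-[-3] (suc m))
    }
    where
    N = suc m ℕ.+ (suc m ℕ.+ suc m)
    M = suc (m ℕ.+ suc m)
    3M : M ℕ.+ (M ℕ.+ M) ≡ N ℕ.+ N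
    3M = lemma m
      where
      lemma : ∀ m → (1 ℕ.+ (m ℕ.+ (1 ℕ.+ m))) ℕ.+ ((1 ℕ.+ (m ℕ.+ (1 ℕ.+ m))) ℕ.+ (1 ℕ.+ (m ℕ.+ (1 ℕ.+ m))))
        ≡ (1 ℕ.+ m ℕ.+ (1 ℕ.+ m ℕ.+ (1 ℕ.+ m))) ℕ.+ (1 ℕ.+ m ℕ.+ (1 ℕ.+ m ℕ.+ (1 ℕ.+ m)))
      lemma = ℕ-Solver.solve-∀
    m-value : ∀ m → + 3 * (+ 2 * (+ 1 + m) + + 1) ≡ + 1 + (+ 1 + m + (+ 1 + m + (+ 1 + m)) + (+ 1 + m + (+ 1 + m + (+ 1 + m)))) + + 2 * + 1
    m-value = solve-∀
    M-value : ∀ m → + 3 * (+ 1 + (m + (+ 1 + m))) ≡ + 1 + (+ 1 + m + (+ 1 + m + (+ 1 + m)) + (+ 1 + m + (+ 1 + m + (+ 1 + m)))) - + 1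
    M-value = solve-∀

  shape₅ : ∀ m → Shape (suc (suc (m ℕ.+ (m ℕ.+ m)))) m
  shape₅ m = record
    { M = suc (m ℕ.+ m) ; d₁ = suc (m ℕ.+ m) ; d₂ = m ; ε = - + 1 ; ε² = refl
    ; m-value = m-value (+ m)
    ; M-value = M-value (+ m)
    ; m<N = cong suc (sym (ℕ.+-suc m (m ℕ.+ m)))
    ; M<N = cong (λ k → suc (suc k)) (sym (ℕ.+-assoc m m m))
    ; sine-m = λ y → sine-previous y (suc (m ℕ.+ (m ℕ.+ m)))
    ; even-m = λ y → even-previous y (suc (m ℕ.+ (m ℕ.+ m)))
    ; cosine-M = λ y → trans (cong (λ n → + 2 * cosine y n) 3M) (cosine-next y (suc (N ℕ.+ N)))
    ; odd-M = λ y → trans (cong (λ n → + 2 * odd y n) 3M) (odd-next y (suc (N ℕ.+ N)))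
    -- N lies two steps beyond the index 3m; running the recursion twice from the values 1 and 0
    -- gives -1.
    ; sine-[-3] = cong₂ (λ b c → b + - + 3 * (c + b) + - + 3 * (c + b + (b + - + 3 * (c + b))) + + 2 * (c + b + (b + - + 3 * (c + b))))
                    (even-[-3] m) (odd-[-3] m)
    }
    where
    N = suc (suc (m ℕ.+ (m ℕ.+ m)))
    M = suc (suc (m ℕ.+ m))
    3M : M ℕ.+ (M ℕ.+ M) ≡ suc (suc (N ℕ.+ N))
    3M = lemma m
      where
      lemma : ∀ m → (2 ℕ.+ (m ℕ.+ m)) ℕ.+ ((2 ℕ.+ (m ℕ.+ m)) ℕ.+ (2 ℕ.+ (m ℕ.+ m)))
        ≡ 2 ℕ.+ ((2 ℕ.+ (m ℕ.+ (m ℕ.+ m))) ℕ.+ (2 ℕ.+ (m ℕ.+ (m ℕ.+ m))))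
      lemma = ℕ-Solver.solve-∀
    m-value : ∀ m → + 3 * (+ 2 * m + + 1) ≡ + 1 + (+ 2 + (m + (m + m)) + (+ 2 + (m + (m + m)))) + + 2 * - + 1
    m-value = solve-∀
    M-value : ∀ m → + 3 * (+ 2 + (m + m)) ≡ + 1 + (+ 2 + (m + (m + m)) + (+ 2 + (m + (m + m)))) - - + 1
    M-value = solve-∀

  -- Evaluation at the angle w

  module Evaluation (N : ℕ) (p-prime : Prime (suc (N ℕ.+ N))) (3<p : 3 ℕ.< suc (N ℕ.+ N))
                    (m : ℕ) (shape : Shape N m) (T : ℤ) where
    open OddPrime N p-prime 3<p
    open Shape shape

    -- With y₀ = -4sin²w, the numbers 1+y₀, 2+y₀, 3+y₀ and 4+y₀ are -2H, -a, -12T and b, the factors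
    -- in the tripling and addition formulas. β and γ stand for the Legendre symbols of b and e.
    a b e g H y₀ y X β γ τ : ℤ
    a  = + 1 + + 12 * T
    b  = + 1 - + 12 * T
    e  = + 1 + + 4 * T
    g  = + 24 * T ^ 2 + + 6 * T + + 1
    H  = + 1 + + 6 * T
    y₀ = - + 3 * e
    y  = triple y₀
    X  = T ^ 2 * (+ 4 * T + + 1)
    β  = b ^ N
    γ  = e ^ N
    τ  = T ^ N * T ^ N

    -432X : - + 432 * X ≡ y
    -432X = lemma T
      where
      lemma : ∀ T → let y = - + 3 * (+ 1 + + 4 * T) in
        - + 432 * (T * (T * + 1) * (+ 4 * T + + 1)) ≡ y * (+ 3 + y) * (+ 3 + y)
      lemma = solve-∀

    [-3]^N≈ε : (- + 3) ^ N ≈ ε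
    [-3]^N≈ε = ≈-trans (≈-sym (sine≈ (- + 3))) (≡⇒≈ sine-[-3])

    sine-N : sine y₀ N ≈ ε * γ
    sine-N = ≈-trans (sine≈ y₀) (≈-trans (≡⇒≈ (^-distrib-* (- + 3) e N)) (*-cong [-3]^N≈ε (≈-refl {γ})))

    even-N : even y₀ N ≈ β
    even-N = ≈-trans (even≈ y₀) (≡⇒≈ (cong (_^ N) (lemma T)))
      where
      lemma : ∀ T → + 4 + - + 3 * (+ 1 + + 4 * T) ≡ + 1 - + 12 * T
      lemma = solve-∀

    X^N : X ^ N ≈ τ * γ
    X^N = ≡⇒≈ (trans (cong (_^ N) (lemma T)) (trans (^-distrib-* (T * T) e N) (cong (_* γ) (^-distrib-* T T N))))
      where
      lemma : ∀ T → T * (T * + 1) * (+ 4 * T + + 1) ≡ T * T * (+ 1 + + 4 * T)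
      lemma = solve-∀

    -- Twice sin(3(2m+1)w)/sin w in two ways: tripling gives 2(3+y₀) = -24T times `sine y m`, and
    -- the addition formula expresses it through the angle pw.
    sine-value : + 24 * T * sine y m ≈ ε * (a * γ - b * β)
    sine-value = by₄ (- + 2) (- + 1) a (- ε * b) (≡⇒≈ (sym (sine-triple y₀ m))) (≡⇒≈ (sine-m y₀)) sine-N even-N
      (lemma T ε (sine y m) (sine y₀ (suc (m ℕ.+ (m ℕ.+ m)))) (sine y₀ N) (even y₀ N) γ β)
      where
      lemma : ∀ T ε q s u v γ β →
        let a = + 1 + + 12 * T
            b = + 1 - + 12 * T
            y = - + 3 * (+ 1 + + 4 * T)
        in + 24 * T * q - ε * (a * γ - b * β)
          ≡ - + 2 * ((+ 3 + y) * q - s) + - + 1 * (+ 2 * s - ((+ 2 + y) * u + ε * (+ 4 + y) * v))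
          + a * (u - ε * γ) + - ε * b * (v - β)
      lemma = solve-∀

    ε²≈1 : ε * ε ≈ + 1
    ε²≈1 = ≡⇒≈ ε²

    ε*sine-N : ε * sine y₀ N ≈ γ
    ε*sine-N = by₂ ε γ sine-N ε²≈1 (lemma ε (sine y₀ N) γ)
      where
      lemma : ∀ ε u γ → ε * u - γ ≡ ε * (u - ε * γ) + γ * (ε * ε - + 1)
      lemma = solve-∀

    -- The cosine counterpart, with 2(1+y₀) = -4H in place of -24T.
    even-value : + 4 * H * even y m ≈ a * β + + 3 * e * γ
    even-value = by₄ (- + 2) (- + 1) a (+ 3 * e)
      (≡⇒≈ (sym (even-triple-suc y₀ m))) (≡⇒≈ (even-m y₀)) even-N ε*sine-N
      (lemma T ε (even y m) (even y₀ (suc (m ℕ.+ (m ℕ.+ m)))) (sine y₀ N) (even y₀ N) γ β)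
      where
      lemma : ∀ T ε q s u v γ β →
        let a = + 1 + + 12 * T
            e = + 1 + + 4 * T
            y = - + 3 * (+ 1 + + 4 * T)
        in + 4 * (+ 1 + + 6 * T) * q - (a * β + + 3 * e * γ)
          ≡ - + 2 * ((+ 1 + y) * q - s) + - + 1 * (+ 2 * s - ((+ 2 + y) * v + ε * y * u))
          + a * (v - β) + + 3 * e * (ε * u - γ)
      lemma = solve-∀

    M₁ : ℕ
    M₁ = suc M

    ε*odd-2N+1 : ε * odd y₀ (suc (N ℕ.+ N)) ≈ β * γ
    ε*odd-2N+1 = by₃ ε (even y₀ N) γ (≡⇒≈ (odd-double′ y₀ N)) ε*sine-N even-N
      (lemma ε (odd y₀ (suc (N ℕ.+ N))) (sine y₀ N) (even y₀ N) γ β)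
      where
      lemma : ∀ ε o u v γ β → ε * o - β * γ ≡ ε * (o - v * u) + v * (ε * u - γ) + γ * (v - β)
      lemma = solve-∀

    odd-2N+1 : odd y₀ (suc (N ℕ.+ N)) ≈ ε * (β * γ)
    odd-2N+1 = by₂ ε (- odd y₀ (suc (N ℕ.+ N))) ε*odd-2N+1 ε²≈1 (lemma ε (odd y₀ (suc (N ℕ.+ N))) (β * γ))
      where
      lemma : ∀ ε o z → o - ε * z ≡ ε * (ε * o - z) + - o * (ε * ε - + 1)
      lemma = solve-∀

    -- 2cos(2pw) ≈ bβ² - 2, and bβ² ≈ b by Fermat's theorem; what remains is 2cos(2w) = -a.
    cosine-2N+1 : cosine y₀ (suc (N ℕ.+ N)) ≈ - a
    cosine-2N+1 = by₃ (+ 1) (b * (even y₀ N + β)) (+ 1) (≡⇒≈ (cosine-double y₀ N)) even-N (fermat b)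
      (lemma T (cosine y₀ (suc (N ℕ.+ N))) (even y₀ N) β)
      where
      lemma : ∀ T w v β →
        let b = + 1 - + 12 * T
            y = - + 3 * (+ 1 + + 4 * T)
        in w - - (+ 1 + + 12 * T)
          ≡ + 1 * (w - ((+ 4 + y) * v * v - + 2)) + b * (v + β) * (v - β) + + 1 * (b * (β * β) - b)
      lemma = solve-∀

    cosine-value : + 2 * cosine y M₁ ≈ a * a + + 3 * e * b * (β * γ)
    cosine-value = by₄ (- + 2) (+ 1) (- a) (+ 3 * e * b)
      (≡⇒≈ (cosine-triple y₀ M₁)) (≡⇒≈ (cosine-M y₀)) cosine-2N+1 ε*odd-2N+1
      (lemma T ε (cosine y M₁) (cosine y₀ (M₁ ℕ.+ (M₁ ℕ.+ M₁))) (cosine y₀ (suc (N ℕ.+ N))) (odd y₀ (suc (N ℕ.+ N))) (β * γ))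
      where
      lemma : ∀ T ε V V₀ w o z →
        let a = + 1 + + 12 * T
            b = + 1 - + 12 * T
            e = + 1 + + 4 * T
            y = - + 3 * (+ 1 + + 4 * T)
        in + 2 * V - (a * a + + 3 * e * b * z)
          ≡ - + 2 * (V₀ - V) + + 1 * (+ 2 * V₀ - ((+ 2 + y) * w - ε * y * (+ 4 + y) * o))
          + - a * (w - - a) + + 3 * e * b * (ε * o - z)
      lemma = solve-∀

    -- The factor 48TH is 2(1+y₀)(3+y₀), where (1+y₀)(3+y₀) = sin 6w/sin 2w comes from tripling.
    odd-value : + 48 * T * H * odd y M₁ ≈ ε * a * (+ 1 - β * γ)
    odd-value = by₄ (- + 2) (+ 1) (- a) (- ε)
      (≡⇒≈ (odd-triple y₀ M₁)) (≡⇒≈ (odd-M y₀)) odd-2N+1 cosine-2N+1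
      (lemma T ε (odd y M₁) (odd y₀ (M₁ ℕ.+ (M₁ ℕ.+ M₁))) (cosine y₀ (suc (N ℕ.+ N))) (odd y₀ (suc (N ℕ.+ N))) (β * γ))
      where
      lemma : ∀ T ε O O₀ w o z →
        let a = + 1 + + 12 * T
            y = - + 3 * (+ 1 + + 4 * T)
        in + 48 * T * (+ 1 + + 6 * T) * O - ε * a * (+ 1 - z)
          ≡ - + 2 * (O₀ - (+ 1 + y) * (+ 3 + y) * O) + + 1 * (+ 2 * O₀ - ((+ 2 + y) * o - ε * w))
          + - a * (o - ε * z) + - ε * (w - - a)
      lemma = solve-∀

    m≈ : + 3 * (+ 2 * + m + + 1) ≈ + 2 * ε
    m≈ = by₂ (+ 1) (+ 1) (≡⇒≈ m-value) p≈0 (lemma (+ 3 * (+ 2 * + m + + 1)) (+ p) ε)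
      where
      lemma : ∀ x p ε → x - + 2 * ε ≡ + 1 * (x - (p + + 2 * ε)) + + 1 * (p - + 0)
      lemma = solve-∀

    M≈ : + 3 * + M₁ ≈ - ε
    M≈ = by₂ (+ 1) (+ 1) (≡⇒≈ M-value) p≈0 (lemma (+ 3 * + M₁) (+ p) ε)
      where
      lemma : ∀ x p ε → x - - ε ≡ + 1 * (x - (p - ε)) + + 1 * (p - + 0)
      lemma = solve-∀

    -- (6m+1)(6m+5) = (6m+3)² - 4, and 6m+3 ≈ 2ε.
    m-root : (+ 6 * + m + + 1) * (+ 6 * + m + + 5) ≈ + 0
    m-root = by₂ (+ 3 * (+ 2 * + m + + 1) + + 2 * ε) (+ 4) m≈ ε²≈1 (lemma (+ m) ε)
      where
      lemma : ∀ m ε → (+ 6 * m + + 1) * (+ 6 * m + + 5) - + 0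
        ≡ (+ 3 * (+ 2 * m + + 1) + + 2 * ε) * (+ 3 * (+ 2 * m + + 1) - + 2 * ε) + + 4 * (ε * ε - + 1)
      lemma = solve-∀

    M-root : + 9 * + M₁ * + M₁ ≈ + 1
    M-root = by₂ (+ 3 * + M₁ - ε) (+ 1) M≈ ε²≈1 (lemma (+ M₁) ε)
      where
      lemma : ∀ m ε → + 9 * m * m - + 1 ≡ (+ 3 * m - ε) * (+ 3 * m - - ε) + + 1 * (ε * ε - + 1)
      lemma = solve-∀

    module _ (κ : ℤ) (κ≈ : + 4 * κ ≈ + 3 * ε) where

      -- From 3(2m+1) ≈ 2ε one gets 1/(2(2m+1)) ≈ 3/(4ε) = 3ε/4, the origin of the condition on κ.
      κ-inverse : + 2 * (+ 2 * + m + + 1) * κ ≈ + 1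
      κ-inverse = *-cancelˡ (+ 3) 3≉0 (by₃ (+ 2 * κ) ε (+ 3) m≈ κ≈ ε²≈1 (lemma (+ m) κ ε))
        where
        lemma : ∀ m κ ε → + 3 * (+ 2 * (+ 2 * m + + 1) * κ) - + 3 * + 1
          ≡ + 2 * κ * (+ 3 * (+ 2 * m + + 1) - + 2 * ε) + ε * (+ 4 * κ - + 3 * ε) + + 3 * (ε * ε - + 1)
        lemma = solve-∀

      lower-sine : + 32 * T * (κ * sine y m) ≈ a * γ - b * β
      lower-sine = *-cancelˡ (+ 3) 3≉0 (by₃ (+ 4 * κ) (ε * (a * γ - b * β)) (+ 3 * (a * γ - b * β)) sine-value κ≈ ε²≈1
        (lemma T κ ε (sine y m) (a * γ - b * β)))
        where
        lemma : ∀ T κ ε q z → + 3 * (+ 32 * T * (κ * q)) - + 3 * z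
          ≡ + 4 * κ * (+ 24 * T * q - ε * z) + ε * z * (+ 4 * κ - + 3 * ε) + + 3 * z * (ε * ε - + 1)
        lemma = solve-∀

      lower-even : + 8 * H * ((κ * (+ 2 * + m + + 1)) * even y m) ≈ a * β + + 3 * e * γ
      lower-even = by₂ (+ 4 * H * even y m) (+ 1) κ-inverse even-value
        (lemma (+ m) κ H (even y m) (a * β + + 3 * e * γ))
        where
        lemma : ∀ m κ H E z → + 8 * H * ((κ * (+ 2 * m + + 1)) * E) - z
          ≡ + 4 * H * E * (+ 2 * (+ 2 * m + + 1) * κ - + 1) + + 1 * (+ 4 * H * E - z)
        lemma = solve-∀

    -- X^N = T^(2N) e^N, but T^(2N) ≈ 1 fails for T ≈ 0. Multiplied by T the relation follows from
    -- Fermat's theorem for every T, as is needed where only 1+6t is known to be a unit.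
    T*X^N : T * X ^ N ≈ T * γ
    T*X^N = by₂ T γ X^N (fermat T) (lemma T (X ^ N) τ γ)
      where
      lemma : ∀ T x τ γ → T * x - T * γ ≡ T * (x - τ * γ) + γ * (T * τ - T)
      lemma = solve-∀

    module _ (σ : ℤ) (σ≈ : + 8 * σ ≈ - + 1) where

      -- The product γ·eβγ collapses to eβ by Fermat's theorem for e, so each Legendre symbol ends
      -- up alone.
      upper-cosine : + 32 * T * (X ^ N * (σ * cosine y M₁)) ≈ - (+ 2 * T * a * a * γ) - + 6 * T * e * b * β
      upper-cosine = by₄ (+ 32 * σ * V) (+ 4 * T * γ * V) (- (+ 2 * T * γ)) (- (+ 6 * T * b * β))
        T*X^N σ≈ cosine-value (fermat e) (lemma T (X ^ N) σ V β γ a b e)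
        where
        V = cosine y M₁
        lemma : ∀ T x σ V β γ a b e → + 32 * T * (x * (σ * V)) - (- (+ 2 * T * a * a * γ) - + 6 * T * e * b * β)
          ≡ + 32 * σ * V * (T * x - T * γ) + + 4 * T * γ * V * (+ 8 * σ - - + 1)
          + - (+ 2 * T * γ) * (+ 2 * V - (a * a + + 3 * e * b * (β * γ)))
          + - (+ 6 * T * b * β) * (e * (γ * γ) - e)
        lemma = solve-∀

      -- y = -3e(12T)² contains T twice: one factor meets the 48T of `odd-value`, the other makes
      -- `T*X^N` applicable, so no division by T occurs.
      upper-odd : + 8 * H * (X ^ N * (+ 2 * σ * + M₁ * (y * odd y M₁))) ≈ + 6 * T * e * a * β - + 6 * T * e * a * γ
      upper-odd = by₃ (- (+ 6 * e * a * (+ 1 - β * γ))) (X ^ N) (+ 6 * T * a * β)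
        T*X^N Z≈ (fermat e) (lemma T (X ^ N) H (+ 2 * σ * + M₁) (y * O) β γ a e)
        where
        O = odd y M₁
        ρ = + 2 * σ * + M₁
        lemma : ∀ T x H ρ z β γ a e → + 8 * H * (x * (ρ * z)) - (+ 6 * T * e * a * β - + 6 * T * e * a * γ)
          ≡ - (+ 6 * e * a * (+ 1 - β * γ)) * (T * x - T * γ)
          + x * (+ 8 * H * (ρ * z) - - (+ 6 * T * e * a * (+ 1 - β * γ)))
          + + 6 * T * a * β * (e * (γ * γ) - e)
        lemma = solve-∀
        ρ≈ : + 12 * ρ ≈ ε
        ρ≈ = by₂ (+ 8 * σ) (- ε) M≈ σ≈ (lemma′ σ (+ M₁) ε)
          where
          lemma′ : ∀ σ m ε → + 12 * (+ 2 * σ * m) - ε ≡ + 8 * σ * (+ 3 * m - - ε) + - ε * (+ 8 * σ - - + 1)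
          lemma′ = solve-∀
        Z≈ : + 8 * H * (ρ * (y * O)) ≈ - (+ 6 * T * e * a * (+ 1 - β * γ))
        Z≈ = by₃ (- (+ 72 * T * e * ρ)) (- (+ 6 * T * e * ε * a * (+ 1 - β * γ))) (- (+ 6 * T * e * a * (+ 1 - β * γ)))
          odd-value ρ≈ ε²≈1 (lemma′ T ρ ε O a (+ 1 - β * γ))
          where
          lemma′ : ∀ T ρ ε O a z →
            let e = + 1 + + 4 * T
                H = + 1 + + 6 * T
                y = - + 3 * e
            in + 8 * H * (ρ * (y * (+ 3 + y) * (+ 3 + y) * O)) - - (+ 6 * T * e * a * z)
              ≡ - (+ 72 * T * e * ρ) * (+ 48 * T * H * O - ε * a * z)
              + - (+ 6 * T * e * ε * a * z) * (+ 12 * ρ - ε) + - (+ 6 * T * e * a * z) * (ε * ε - + 1)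
          lemma′ = solve-∀

  -- Residues of the partial sums

  cast-2k+1 : ∀ k → + (2 ℕ.* k ℕ.+ 1) ≡ + 2 * + k + + 1
  cast-2k+1 k = cong (_+ + 1) (pos-* 2 k)

  S₁ : ℕ → ℚ
  S₁ k = ℕ→ℚ (2 ℕ.* k ℕ.+ 1) ℚ.* S k

  module Sums (N : ℕ) (p-prime : Prime (suc (N ℕ.+ N))) (3<p : 3 ℕ.< suc (N ℕ.+ N))
              (m : ℕ) (shape : Shape N m) {t : ℚ} {T : ℤ} where
    open OddPrime N p-prime 3<p
    open Reduction N p-prime 3<p
    open SMod N p-prime 3<p
    open Evaluation N p-prime 3<p m shape T
    open Shape shape

    u : ℚ
    u = (t ^ℚ 2) ℚ.* (ℕ→ℚ 4 ℚ.* t ℚ.+ 1ℚ)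

    module _ (t~T : t ~ T) where

      u~X : u ~ X
      u~X = ~-* (~-^ 2 t~T) (~-+ (~-* (~-ℤ (+ 4)) t~T) (~-ℤ (+ 1)))

      lowerSum : ∀ K κ (f : ℕ → ℤ) {s : ℕ → ℚ} → (∀ k → k ℕ.≤ K → s k ~ κ * ((- + 432) ^ k * f k)) →
        sumTo K (λ k → s k ℚ.* (u ^ℚ k)) ~ κ * eval K f y
      lowerSum K κ f h = ~-resp-≈ (~-sumTo K (λ k k≤K → ~-* (h k k≤K) (~-^ k u~X)))
        (≡⇒≈ (trans (scaled-eval K κ (- + 432) f X) (cong (λ z → κ * eval K f z) -432X)))

      upperSum : ∀ σ (f : ℕ → ℤ) {s : ℕ → ℚ} → (∀ j → j ℕ.≤ N → s (N ℕ.+ j) ~ σ * ((- + 432) ^ j * f j)) →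
        sumTo N (λ j → s (N ℕ.+ j) ℚ.* (u ^ℚ (N ℕ.+ j))) ~ X ^ N * (σ * eval N f y)
      upperSum σ f h = ~-resp-≈ (~-sumTo N (λ j j≤N → ~-* (h j j≤N) (~-^ (N ℕ.+ j) u~X)))
        (≡⇒≈ (trans (sum-cong N (λ j → trans (cong (σ * ((- + 432) ^ j * f j) *_) (^-distribˡ-+-* X N j))
                                              (lemma (σ * ((- + 432) ^ j * f j)) (X ^ N) (X ^ j))))
             (trans (sum-* N (X ^ N) (λ j → σ * ((- + 432) ^ j * f j) * X ^ j))
             (cong (X ^ N *_) (trans (scaled-eval N σ (- + 432) f X) (cong (λ z → σ * eval N f z) -432X))))))
        where
        lemma : ∀ a b c → a * (b * c) ≡ b * (a * c)
        lemma = solve-∀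

      module _ (κ : ℤ) (κ≈ : + 4 * κ ≈ + 3 * ε) where

        ≤⇒<N : ∀ {k d} → d ℕ.≤ d₁ → k ℕ.≤ m ℕ.+ d → k ℕ.< N
        ≤⇒<N d≤d₁ k≤ = ℕ.<-≤-trans (s≤s (ℕ.≤-trans k≤ (ℕ.+-monoʳ-≤ m d≤d₁))) (ℕ.≤-reflexive (sym m<N))

        -- One statement for two sums: d = 0 ends at ⌊p/6⌋ and d = d₁ at N-1. Their residues agree
        -- since `sinCoef m k` vanishes for k > m.
        lower : ∀ {d} → d ℕ.≤ d₁ → sumTo (m ℕ.+ d) (λ k → S k ℚ.* (u ^ℚ k)) ~ κ * sine y m
        lower {d} d≤d₁ = ~-resp-≈ (lowerSum (m ℕ.+ d) κ (sinCoef m) {S}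
            (λ k k≤ → S-lower m κ (κ-inverse κ κ≈) m-root k (≤⇒<N d≤d₁ k≤)))
          (≡⇒≈ (cong (κ *_) (eval-sinCoef m d y)))

        -- `sinCoef-even` absorbs the weight 2k+1 and turns the sine quotient into the cosine
        -- quotient.
        lower₁ : ∀ {d} → d ℕ.≤ d₁ → sumTo (m ℕ.+ d) (λ k → S₁ k ℚ.* (u ^ℚ k)) ~ (κ * (+ 2 * + m + + 1)) * even y m
        lower₁ {d} d≤d₁ = ~-resp-≈ (lowerSum (m ℕ.+ d) (κ * (+ 2 * + m + + 1)) (evenCoef m) {S₁}
            (λ k k≤ → ~-resp-≈ (~-* (~-ℤ (+ (2 ℕ.* k ℕ.+ 1))) (S-lower m κ (κ-inverse κ κ≈) m-root k (≤⇒<N d≤d₁ k≤)))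
              (by₂ (κ * ((- + 432) ^ k * sinCoef m k)) (κ * (- + 432) ^ k) (≡⇒≈ (cast-2k+1 k)) (≡⇒≈ (sinCoef-even m k))
                (lemma (+ (2 ℕ.* k ℕ.+ 1)) (+ k) (+ m) κ ((- + 432) ^ k) (sinCoef m k) (evenCoef m k)))))
          (≡⇒≈ (cong (κ * (+ 2 * + m + + 1) *_) (eval-evenCoef m d y)))
          where
          lemma : ∀ w k m κ c q b → w * (κ * (c * q)) - (κ * (+ 2 * m + + 1)) * (c * b)
            ≡ κ * (c * q) * (w - (+ 2 * k + + 1)) + κ * c * ((+ 2 * k + + 1) * q - (+ 2 * m + + 1) * b)
          lemma = solve-∀

      module _ (σ : ℤ) (σ≈ : + 8 * σ ≈ - + 1) (r : ℕ) (N≡2+r : N ≡ 2 ℕ.+ r) where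

        middle : S N ~ + 2 * σ
        middle = S-middle r N≡2+r (+ 2 * σ) (≈-trans (≡⇒≈ (lemma σ)) σ≈)
          where
          lemma : ∀ σ → + 4 * (+ 2 * σ) ≡ + 8 * σ
          lemma = solve-∀

        upper : sumTo N (λ j → S (N ℕ.+ j) ℚ.* (u ^ℚ (N ℕ.+ j))) ~ X ^ N * (σ * cosine y M₁)
        upper = ~-resp-≈ (upperSum σ (cosCoef M₁) {S} (S-upper M₁ σ middle M-root))
          (≡⇒≈ (cong (λ z → X ^ N * (σ * z)) (trans (cong (λ n → eval n (cosCoef M₁) y) M<N) (eval-cosCoef M d₂ y))))

        -- The weight 2(N+j)+1 is 2j modulo p, so the weighted polynomial is 2y times the derivative
        -- of 2cos(2M₁z) in y, which is M₁ sin(2M₁z)/sin(2z).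
        upper₁ : sumTo N (λ j → S₁ (N ℕ.+ j) ℚ.* (u ^ℚ (N ℕ.+ j))) ~ X ^ N * (+ 2 * σ * + M₁ * (y * odd y M₁))
        upper₁ = ~-resp-≈ (upperSum (+ 2 * σ * + M₁) (shift (oddCoef M₁)) {S₁}
            (λ j j≤N → ~-resp-≈ (~-* (~-ℤ (+ (2 ℕ.* (N ℕ.+ j) ℕ.+ 1))) (S-upper M₁ σ middle M-root j j≤N)) (coef j)))
          (≡⇒≈ (cong (λ z → X ^ N * (+ 2 * σ * + M₁ * z))
            (trans (cong (λ n → eval n (shift (oddCoef M₁)) y) M<N) (eval-shift M d₂ y))))
          where
          derivative : ∀ j → + j * cosCoef M₁ j ≡ + M₁ * shift (oddCoef M₁) j
          derivative zero    = sym (*-zeroʳ (+ M₁))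
          derivative (suc j) = lin₁ (+ 1) (cosCoef-odd M₁ j) (lemma (+ j) (cosCoef M₁ (suc j)) (+ M₁ * oddCoef M₁ j))
            where
            lemma : ∀ j v z → (+ 1 + j) * v - z ≡ + 1 * ((j + + 1) * v - z)
            lemma = solve-∀
          coef : ∀ j → + (2 ℕ.* (N ℕ.+ j) ℕ.+ 1) * (σ * ((- + 432) ^ j * cosCoef M₁ j))
               ≈ + 2 * σ * + M₁ * ((- + 432) ^ j * shift (oddCoef M₁) j)
          coef j = by₃ (σ * ((- + 432) ^ j * cosCoef M₁ j)) (σ * ((- + 432) ^ j * cosCoef M₁ j)) (+ 2 * σ * (- + 432) ^ j)
            (≡⇒≈ (cast-2k+1 (N ℕ.+ j))) p≈0 (≡⇒≈ (derivative j))
            (lemma (+ (2 ℕ.* (N ℕ.+ j) ℕ.+ 1)) (+ N) (+ j) σ ((- + 432) ^ j) (cosCoef M₁ j) (+ M₁) (shift (oddCoef M₁) j))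
            where
            lemma : ∀ w n j σ c v m o → w * (σ * (c * v)) - + 2 * σ * m * (c * o)
              ≡ σ * (c * v) * (w - (+ 2 * (n + j) + + 1)) + σ * (c * v) * (+ 1 + (n + n) - + 0)
              + + 2 * σ * c * (j * v - m * o)
            lemma = solve-∀

  -- Primes modulo 6

  N≥2 : ∀ N → 3 ℕ.< suc (N ℕ.+ N) → ∃ λ r → N ≡ 2 ℕ.+ r
  N≥2 zero          (s≤s ())
  N≥2 (suc zero)    (s≤s (s≤s (s≤s ())))
  N≥2 (suc (suc r)) _ = r , refl

  -- Residues 0, 2, 3 and 4 modulo 6 would give p the divisor 2 or 3; residue 1 with quotient 0
  -- would give p = 1.
  shape-of-prime : ∀ {p} → Prime p → 3 ℕ.< p → ∃ λ N → p ≡ suc (N ℕ.+ N) × Shape N (p ℕ./ 6)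
  shape-of-prime {p} p-prime 3<p = go (p ℕ./ 6) (p ℕ.% 6) (m%n<n p 6) (m≡m%n+[m/n]*n p 6)
    where
    no-divisor : ∀ d q → 1 ℕ.< d → d ℕ.≤ 3 → p ≡ q ℕ.* d → ⊥
    no-divisor d q 1<d d≤3 eq =
      [ (λ d≡1 → ℕ.<⇒≢ 1<d (sym d≡1)) , (λ d≡p → ℕ.<⇒≢ (ℕ.≤-<-trans d≤3 3<p) d≡p) ]′
      (prime⇒irreducible p-prime (ℕ.divides q eq))
    1<2 : 1 ℕ.< 2
    1<2 = s≤s (s≤s z≤n)
    go : ∀ m r → r ℕ.< 6 → p ≡ r ℕ.+ m ℕ.* 6 → ∃ λ N → p ≡ suc (N ℕ.+ N) × Shape N m
    go m 0 _ eq = ⊥-elim (no-divisor 2 (m ℕ.* 3) 1<2 (s≤s (s≤s z≤n)) (trans eq (lemma m)))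
      where
      lemma : ∀ m → m ℕ.* 6 ≡ m ℕ.* 3 ℕ.* 2
      lemma = ℕ-Solver.solve-∀
    go zero 1 _ eq = ⊥-elim (ℕ.<-asym 3<p (subst (ℕ._< 3) (sym eq) 1<3))
      where
      1<3 : 1 ℕ.< 3
      1<3 = s≤s (s≤s z≤n)
    go (suc m) 1 _ eq = _ , trans eq (lemma m) , shape₁ m
      where
      lemma : ∀ m → 1 ℕ.+ (1 ℕ.+ m) ℕ.* 6 ≡ 1 ℕ.+ (1 ℕ.+ m ℕ.+ (1 ℕ.+ m ℕ.+ (1 ℕ.+ m)) ℕ.+ (1 ℕ.+ m ℕ.+ (1 ℕ.+ m ℕ.+ (1 ℕ.+ m))))
      lemma = ℕ-Solver.solve-∀
    go m 2 _ eq = ⊥-elim (no-divisor 2 (1 ℕ.+ m ℕ.* 3) 1<2 (s≤s (s≤s z≤n)) (trans eq (lemma m)))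
      where
      lemma : ∀ m → 2 ℕ.+ m ℕ.* 6 ≡ (1 ℕ.+ m ℕ.* 3) ℕ.* 2
      lemma = ℕ-Solver.solve-∀
    go m 3 _ eq = ⊥-elim (no-divisor 3 (1 ℕ.+ m ℕ.* 2) (s≤s (s≤s z≤n)) ℕ.≤-refl (trans eq (lemma m)))
      where
      lemma : ∀ m → 3 ℕ.+ m ℕ.* 6 ≡ (1 ℕ.+ m ℕ.* 2) ℕ.* 3
      lemma = ℕ-Solver.solve-∀
    go m 4 _ eq = ⊥-elim (no-divisor 2 (2 ℕ.+ m ℕ.* 3) 1<2 (s≤s (s≤s z≤n)) (trans eq (lemma m)))
      where
      lemma : ∀ m → 4 ℕ.+ m ℕ.* 6 ≡ (2 ℕ.+ m ℕ.* 3) ℕ.* 2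
      lemma = ℕ-Solver.solve-∀
    go m 5 _ eq = _ , trans eq (lemma m) , shape₅ m
      where
      lemma : ∀ m → 5 ℕ.+ m ℕ.* 6 ≡ 1 ℕ.+ (2 ℕ.+ (m ℕ.+ (m ℕ.+ m)) ℕ.+ (2 ℕ.+ (m ℕ.+ (m ℕ.+ m))))
      lemma = ℕ-Solver.solve-∀
    go m (suc (suc (suc (suc (suc (suc r)))))) (s≤s (s≤s (s≤s (s≤s (s≤s (s≤s ()))))))

  -- The four congruences

  module Conclusion (N : ℕ) (p-prime : Prime (suc (N ℕ.+ N))) (3<p : 3 ℕ.< suc (N ℕ.+ N))
                    (m : ℕ) (shape : Shape N m) {t : ℚ} {T : ℤ} where
    open OddPrime N p-prime 3<p
    open Reduction N p-prime 3<p
    open Evaluation N p-prime 3<p m shape T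
    open Sums N p-prime 3<p m shape {t} {T}
    open Shape shape

    8≉0 : + 8 ≉ + 0
    8≉0 = *-≉0 2≉0 4≉0

    32≉0 : + 32 ≉ + 0
    32≉0 = *-≉0 4≉0 8≉0

    scale-lower : ∃ λ κ → + 4 * κ ≈ + 3 * ε
    scale-lower = rescale (inverse 4≉0)
      where
      lemma : ∀ ε i → + 4 * (+ 3 * ε * i) - + 3 * ε ≡ + 3 * ε * (+ 4 * i - + 1)
      lemma = solve-∀
      rescale : (∃ λ i → + 4 * i ≈ + 1) → ∃ λ κ → + 4 * κ ≈ + 3 * ε
      rescale (i , h) = + 3 * ε * i , by₁ (+ 3 * ε) h (lemma ε i)

    scale-upper : ∃ λ σ → + 8 * σ ≈ - + 1
    scale-upper = rescale (inverse 8≉0)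
      where
      lemma : ∀ i → + 8 * - i - - + 1 ≡ - + 1 * (+ 8 * i - + 1)
      lemma = solve-∀
      rescale : (∃ λ i → + 8 * i ≈ + 1) → ∃ λ σ → + 8 * σ ≈ - + 1
      rescale (i , h) = - i , by₁ (- + 1) h (lemma i)

    -- P·i and Q·i are the residues of the fractions P/d and Q/d that stand in the formulas.
    divide : ∀ d {i s} P Q u v → d * i ≈ + 1 → d * s ≈ P * u + Q * v → s ≈ P * i * u + Q * i * v
    divide d {i} {s} P Q u v inv h = by₂ i (- s) h inv (lemma d i s P Q u v)
      where
      lemma : ∀ d i s P Q u v → s - (P * i * u + Q * i * v) ≡ i * (d * s - (P * u + Q * v)) + - s * (d * i - + 1)
      lemma = solve-∀

    divide₋ : ∀ d {i s} P Q u v → d * i ≈ + 1 → d * s ≈ P * u - Q * v → s ≈ P * i * u - Q * i * v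
    divide₋ d {i} {s} P Q u v inv h = by₂ i (- s) h inv (lemma d i s P Q u v)
      where
      lemma : ∀ d i s P Q u v → s - (P * i * u - Q * i * v) ≡ i * (d * s - (P * u - Q * v)) + - s * (d * i - + 1)
      lemma = solve-∀

    aℚ bℚ eℚ fℚ gℚ hℚ : ℚ
    aℚ = 1ℚ ℚ.+ ℕ→ℚ 12 ℚ.* t
    bℚ = 1ℚ ℚ.- ℕ→ℚ 12 ℚ.* t
    eℚ = 1ℚ ℚ.+ ℕ→ℚ 4 ℚ.* t
    fℚ = 1ℚ ℚ.- ℕ→ℚ 6 ℚ.* t
    gℚ = ℕ→ℚ 24 ℚ.* (t ^ℚ 2) ℚ.+ ℕ→ℚ 6 ℚ.* t ℚ.+ 1ℚ
    hℚ = 1ℚ ℚ.+ ℕ→ℚ 6 ℚ.* t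

    κ : ℤ
    κ = proj₁ scale-lower

    κ≈ : + 4 * κ ≈ + 3 * ε
    κ≈ = proj₂ scale-lower

    σ : ℤ
    σ = proj₁ scale-upper

    σ≈ : + 8 * σ ≈ - + 1
    σ≈ = proj₂ scale-upper

    -- The two halves combine through 1 - 2Ta = e(1-6T) and 1 + 6Te = g; the same identities serve
    -- `long₁-value`.
    long-value : + 32 * T * (κ * sine y m + X ^ N * (σ * cosine y M₁)) ≈ a * e * (+ 1 - + 6 * T) * γ - b * g * β
    long-value = by₂ (+ 1) (+ 1) (lower-sine κ κ≈) (upper-cosine σ σ≈)
      (lemma T (κ * sine y m) (X ^ N * (σ * cosine y M₁)) γ β)
      where
      lemma : ∀ T s s′ γ β →
        let a = + 1 + + 12 * T
            b = + 1 - + 12 * T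
            e = + 1 + + 4 * T
            g = + 24 * (T * (T * + 1)) + + 6 * T + + 1
        in + 32 * T * (s + s′) - (a * e * (+ 1 - + 6 * T) * γ - b * g * β)
          ≡ + 1 * (+ 32 * T * s - (a * γ - b * β))
          + + 1 * (+ 32 * T * s′ - (- (+ 2 * T * a * a * γ) - + 6 * T * e * b * β))
      lemma = solve-∀

    long₁-value : + 8 * H * ((κ * (+ 2 * + m + + 1)) * even y m + X ^ N * (+ 2 * σ * + M₁ * (y * odd y M₁)))
      ≈ a * g * β + + 3 * (+ 1 - + 6 * T) * e ^ 2 * γ
    long₁-value = by₂ (+ 1) (+ 1) (lower-even κ κ≈) (upper-odd σ σ≈)
      (lemma T ((κ * (+ 2 * + m + + 1)) * even y m) (X ^ N * (+ 2 * σ * + M₁ * (y * odd y M₁))) γ β)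
      where
      lemma : ∀ T s s′ γ β →
        let a = + 1 + + 12 * T
            e = + 1 + + 4 * T
            g = + 24 * (T * (T * + 1)) + + 6 * T + + 1
            H = + 1 + + 6 * T
        in + 8 * H * (s + s′) - (a * g * β + + 3 * (+ 1 - + 6 * T) * (e * (e * + 1)) * γ)
          ≡ + 1 * (+ 8 * H * s - (a * β + + 3 * e * γ))
          + + 1 * (+ 8 * H * s′ - (+ 6 * T * e * a * β - + 6 * T * e * a * γ))
      lemma = solve-∀

    module _ (t~T : t ~ T) where

      a~ : aℚ ~ a
      a~ = ~-+ (~-ℤ (+ 1)) (~-* (~-ℤ (+ 12)) t~T)

      b~ : bℚ ~ b
      b~ = ~-+ (~-ℤ (+ 1)) (~-neg (~-* (~-ℤ (+ 12)) t~T))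

      e~ : eℚ ~ e
      e~ = ~-+ (~-ℤ (+ 1)) (~-* (~-ℤ (+ 4)) t~T)

      f~ : fℚ ~ + 1 - + 6 * T
      f~ = ~-+ (~-ℤ (+ 1)) (~-neg (~-* (~-ℤ (+ 6)) t~T))

      g~ : gℚ ~ g
      g~ = ~-+ (~-+ (~-* (~-ℤ (+ 24)) (~-^ 2 t~T)) (~-* (~-ℤ (+ 6)) t~T)) (~-ℤ (+ 1))

      h~ : hℚ ~ H
      h~ = ~-+ (~-ℤ (+ 1)) (~-* (~-ℤ (+ 6)) t~T)

      short : sumTo m (λ k → S k ℚ.* (u ^ℚ k)) ~ κ * sine y m
      short = subst (λ n → sumTo n (λ k → S k ℚ.* (u ^ℚ k)) ~ κ * sine y m) (ℕ.+-identityʳ m) (lower t~T κ κ≈ z≤n)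

      short₁ : sumTo m (λ k → S₁ k ℚ.* (u ^ℚ k)) ~ (κ * (+ 2 * + m + + 1)) * even y m
      short₁ = subst (λ n → sumTo n (λ k → S₁ k ℚ.* (u ^ℚ k)) ~ (κ * (+ 2 * + m + + 1)) * even y m)
        (ℕ.+-identityʳ m) (lower₁ t~T κ κ≈ z≤n)

      long : sumTo (N ℕ.+ N) (λ k → S k ℚ.* (u ^ℚ k)) ~ κ * sine y m + X ^ N * (σ * cosine y M₁)
      long = subst (_~ (κ * sine y m + X ^ N * (σ * cosine y M₁))) (sym (sumTo-half m<N (λ k → S k ℚ.* (u ^ℚ k))))
        (~-+ (lower t~T κ κ≈ ℕ.≤-refl) (upper t~T σ σ≈ (proj₁ (N≥2 N 3<p)) (proj₂ (N≥2 N 3<p))))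

      long₁ : sumTo (N ℕ.+ N) (λ k → S₁ k ℚ.* (u ^ℚ k))
            ~ (κ * (+ 2 * + m + + 1)) * even y m + X ^ N * (+ 2 * σ * + M₁ * (y * odd y M₁))
      long₁ = subst (_~ ((κ * (+ 2 * + m + + 1)) * even y m + X ^ N * (+ 2 * σ * + M₁ * (y * odd y M₁))))
        (sym (sumTo-half m<N (λ k → S₁ k ℚ.* (u ^ℚ k))))
        (~-+ (lower₁ t~T κ κ≈ ℕ.≤-refl) (upper₁ t~T σ σ≈ (proj₁ (N≥2 N 3<p)) (proj₂ (N≥2 N 3<p))))

      32t-inverse : ¬ ≡0mod p t → ∃ λ i → + 32 * T * i ≈ + 1
      32t-inverse t≢0 = inverse (*-≉0 32≉0 (λ T≈0 → t≢0 (~⇒≡0mod t~T T≈0)))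

      8h-inverse : ¬ ≡0mod p hℚ → ∃ λ i → + 8 * H * i ≈ + 1
      8h-inverse h≢0 = inverse (*-≉0 8≉0 (λ H≈0 → h≢0 (~⇒≡0mod h~ H≈0)))

      quotient-32t : ∀ {q z i} → q ~ z → + 32 * T * i ≈ + 1 → q ÷ (ℕ→ℚ 32 ℚ.* t) ~ z * i
      quotient-32t q~z inv = ~-÷ q~z (~-* (~-ℤ (+ 32)) t~T) inv

      quotient-8h : ∀ {q z i} → q ~ z → + 8 * H * i ≈ + 1 → q ÷ (ℕ→ℚ 8 ℚ.* hℚ) ~ z * i
      quotient-8h q~z inv = ~-÷ q~z (~-* (~-ℤ (+ 8)) h~) inv


      formula₁ : ∀ {i} → + 32 * T * i ≈ + 1 → sumTo m (λ k → S k ℚ.* (u ^ℚ k))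
        ≡ (aℚ ÷ (ℕ→ℚ 32 ℚ.* t)) ℚ.* legendre eℚ p ℚ.- (bℚ ÷ (ℕ→ℚ 32 ℚ.* t)) ℚ.* legendre bℚ p [modℚ p ]
      formula₁ inv = ~⇒≡mod short
        (~-+ (~-* (quotient-32t a~ inv) (~-legendre e~)) (~-neg (~-* (quotient-32t b~ inv) (~-legendre b~))))
        (divide₋ (+ 32 * T) a b γ β inv (lower-sine κ κ≈))

      formula₂ : ∀ {i} → + 32 * T * i ≈ + 1 → sumTo (N ℕ.+ N) (λ k → S k ℚ.* (u ^ℚ k))
        ≡ ((aℚ ℚ.* eℚ ℚ.* fℚ) ÷ (ℕ→ℚ 32 ℚ.* t)) ℚ.* legendre eℚ p
          ℚ.- ((bℚ ℚ.* gℚ) ÷ (ℕ→ℚ 32 ℚ.* t)) ℚ.* legendre bℚ p [modℚ p ]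
      formula₂ inv = ~⇒≡mod long
        (~-+ (~-* (quotient-32t (~-* (~-* a~ e~) f~) inv) (~-legendre e~))
          (~-neg (~-* (quotient-32t (~-* b~ g~) inv) (~-legendre b~))))
        (divide₋ (+ 32 * T) (a * e * (+ 1 - + 6 * T)) (b * g) γ β inv long-value)

      formula₃ : ∀ {i} → + 8 * H * i ≈ + 1 → sumTo m (λ k → S₁ k ℚ.* (u ^ℚ k))
        ≡ (aℚ ÷ (ℕ→ℚ 8 ℚ.* hℚ)) ℚ.* legendre bℚ p ℚ.+ ((ℕ→ℚ 3 ℚ.* eℚ) ÷ (ℕ→ℚ 8 ℚ.* hℚ)) ℚ.* legendre eℚ p [modℚ p ]
      formula₃ inv = ~⇒≡mod short₁
        (~-+ (~-* (quotient-8h a~ inv) (~-legendre b~)) (~-* (quotient-8h (~-* (~-ℤ (+ 3)) e~) inv) (~-legendre e~)))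
        (divide (+ 8 * H) a (+ 3 * e) β γ inv (lower-even κ κ≈))

      formula₄ : ∀ {i} → + 8 * H * i ≈ + 1 → sumTo (N ℕ.+ N) (λ k → S₁ k ℚ.* (u ^ℚ k))
        ≡ ((aℚ ℚ.* gℚ) ÷ (ℕ→ℚ 8 ℚ.* hℚ)) ℚ.* legendre bℚ p
          ℚ.+ ((ℕ→ℚ 3 ℚ.* fℚ ℚ.* (eℚ ^ℚ 2)) ÷ (ℕ→ℚ 8 ℚ.* hℚ)) ℚ.* legendre eℚ p [modℚ p ]
      formula₄ inv = ~⇒≡mod long₁
        (~-+ (~-* (quotient-8h (~-* a~ g~) inv) (~-legendre b~))
          (~-* (quotient-8h (~-* (~-* (~-ℤ (+ 3)) f~) (~-^ 2 e~)) inv) (~-legendre e~)))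
        (divide (+ 8 * H) (a * g) (+ 3 * (+ 1 - + 6 * T) * e ^ 2) β γ inv long₁-value)

open import Defs
open import Data.Nat as ℕ using (ℕ; suc; _<_)
open import Data.Nat.Primality using (Prime)
open import Data.Product using (_×_; _,_; proj₂; ∃)
open import Data.Rational using (ℚ; _+_; _*_; _-_; 1ℚ)
open import Relation.Binary.PropositionalEquality using (_≡_; refl)
open import Relation.Nullary using (¬_)
open ResidueComputation using (Shape; shape-of-prime; module Reduction; module Conclusion)


Claim : (p m : ℕ) → ℚ → Set
Claim p m t =
  let c : ℕ → ℚ
      c = ℕ→ℚ
      u = (t ^ 2) * (c 4 * t + 1ℚ)
      a = 1ℚ + c 12 * t
      b = 1ℚ - c 12 * t
      e = 1ℚ + c 4 * t
      f = 1ℚ - c 6 * t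
      g = c 24 * (t ^ 2) + c 6 * t + 1ℚ
      h = 1ℚ + c 6 * t
  in (¬ ≡0mod p t →
        (sumTo m (λ k → S k * (u ^ k))
          ≡ (a ÷ (c 32 * t)) * legendre e p - (b ÷ (c 32 * t)) * legendre b p [modℚ p ])
      × (sumTo (p ℕ.∸ 1) (λ k → S k * (u ^ k))
          ≡ ((a * e * f) ÷ (c 32 * t)) * legendre e p
            - ((b * g) ÷ (c 32 * t)) * legendre b p [modℚ p ]))
   × (¬ ≡0mod p h →
        (sumTo m (λ k → c (2 ℕ.* k ℕ.+ 1) * S k * (u ^ k))
          ≡ (a ÷ (c 8 * h)) * legendre b p + ((c 3 * e) ÷ (c 8 * h)) * legendre e p [modℚ p ])
      × (sumTo (p ℕ.∸ 1) (λ k → c (2 ℕ.* k ℕ.+ 1) * S k * (u ^ k))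
          ≡ ((a * g) ÷ (c 8 * h)) * legendre b p
            + ((c 3 * f * (e ^ 2)) ÷ (c 8 * h)) * legendre e p [modℚ p ]))

conclude : ∀ p m t → Prime p → 3 < p → InD p t → (∃ λ N → p ≡ suc (N ℕ.+ N) × Shape N m) → Claim p m t
-- Matching `refl` turns p into `suc (N ℕ.+ N)`, so that p ∸ 1 computes to N + N.
conclude _ m t p-prime 3<p t∈D (N , refl , shape) = from-residue (InD⇒~ {t} t∈D)
  where
  open Reduction N p-prime 3<p
  from-residue : (∃ λ T → t ~ T) → Claim (suc (N ℕ.+ N)) m t
  from-residue (T , t~T) =
    (λ t≢0 → formula₁ t~T (proj₂ (32t-inverse t~T t≢0)) , formula₂ t~T (proj₂ (32t-inverse t~T t≢0))) ,
    (λ h≢0 → formula₃ t~T (proj₂ (8h-inverse t~T h≢0)) , formula₄ t~T (proj₂ (8h-inverse t~T h≢0)))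
    where open Conclusion N p-prime 3<p m shape {t} {T}

theorem36 : (p : ℕ) → Prime p → 3 < p → (t : ℚ) → InD p t →
    let c : ℕ → ℚ
        c = ℕ→ℚ
        u = (t ^ 2) * (c 4 * t + 1ℚ)
        a = 1ℚ + c 12 * t
        b = 1ℚ - c 12 * t
        e = 1ℚ + c 4 * t
        f = 1ℚ - c 6 * t
        g = c 24 * (t ^ 2) + c 6 * t + 1ℚ
        h = 1ℚ + c 6 * t
        m = p ℕ./ 6
    in (¬ ≡0mod p t →
          (sumTo m (λ k → S k * (u ^ k))
            ≡ (a ÷ (c 32 * t)) * legendre e p - (b ÷ (c 32 * t)) * legendre b p [modℚ p ])
        × (sumTo (p ℕ.∸ 1) (λ k → S k * (u ^ k))
            ≡ ((a * e * f) ÷ (c 32 * t)) * legendre e p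
              - ((b * g) ÷ (c 32 * t)) * legendre b p [modℚ p ]))
     × (¬ ≡0mod p h →
          (sumTo m (λ k → c (2 ℕ.* k ℕ.+ 1) * S k * (u ^ k))
            ≡ (a ÷ (c 8 * h)) * legendre b p + ((c 3 * e) ÷ (c 8 * h)) * legendre e p [modℚ p ])
        × (sumTo (p ℕ.∸ 1) (λ k → c (2 ℕ.* k ℕ.+ 1) * S k * (u ^ k))
            ≡ ((a * g) ÷ (c 8 * h)) * legendre b p
              + ((c 3 * f * (e ^ 2)) ÷ (c 8 * h)) * legendre e p [modℚ p ]))
theorem36 p p-prime 3<p t t∈D = conclude p (p ℕ./ 6) t p-prime 3<p t∈D (shape-of-prime p-prime 3<p)
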